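{- Two-player stochastic games with perfect information reduce to their binary counterparts in strongly polynomial time. That is, there is a strongly polynomial procedure that transforms every such game into a game of the same kind in which every state has at most two actions, such that from the solution (game values) of the binary game the solution (game values) of the original game can be computed in strongly polynomial time.
   Context: Write $[n]=\{1,\dots,n\}$. A (discounted) two-player stochastic game with perfect information has $n$ states partitioned as $[n]=S_{\max}\cup S_{\min}$ (states controlled by the max player and by the min player); in state $j$ there are $a_j\ge1$ actions; choosing action $i\in[a_j]$ in state $j$ gives reward $r^j_i\in\mathbb R$ and moves the process to state $k$ with probability $p^j_{ik}\in[0,1]$, $\sum_k p^j_{ik}=1$; rewards are discounted by a factor $\gamma\in[0,1)$ over an infinite-time horizon. Solving the game means finding the unique vector $v\in\mathbb R^n$ (the game values) with $v_j=\max_{i\in[a_j]}\{r^j_i+\gamma\sum_{k=1}^n p^j_{ik}v_k\}$ for $j\in S_{\max}$ and $v_j=\min_{i\in[a_j]}\{r^j_i+\gamma\sum_{k=1}^n p^j_{ik}v_k\}$ for $j\in S_{\min}$. A procedure is strongly polynomial if its number of arithmetic operations (including comparisons) is bounded by a polynomial in the number of states and the total number of actions. -}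

module Defs where

open import Algebra.Bundles using (CommutativeRing)
open import Algebra.Structures using (IsCommutativeRing)
import Algebra.Definitions.RawMonoid as RawMonoidSum
open import Data.Bool using (Bool; true; false; if_then_else_)
open import Data.Fin using (Fin)
open import Data.List using (List; []; _∷_; length; tabulate; applyUpTo)
open import Data.List.Membership.Propositional using (_∈_)
open import Data.List.Relation.Unary.All as All using (All; []; _∷_)
open import Data.Nat as ℕ using (ℕ; zero; suc)
open import Data.Nat.ListAction using (sum)
open import Data.Product using (Σ-syntax; ∃-syntax; _×_; _,_; proj₁; proj₂)
open import Data.Vec.Functional using (Vector)
import Relation.Binary.Construct.NonStrictToStrict as Strict
open import Level using (0ℓ)
open import Relation.Binary.Core using (Rel)
open import Relation.Binary.PropositionalEquality using (_≡_)
open import Relation.Binary.Structures using (IsDecTotalOrder)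
open import Relation.Nullary using (¬_; does)

-- The real numbers, as a complete ordered field.  The order is decidable
-- because comparing two reals is a unit-cost operation of the computation
-- model.  The value of 0# ⁻¹ is left unspecified.
record Reals : Set₁ where
  infix  8 -_ _⁻¹
  infixl 7 _*_
  infixl 6 _+_
  infix  4 _≈_ _≤_
  field
    Carrier : Set
    _≈_ _≤_ : Rel Carrier 0ℓ
    _+_ _*_ : Carrier → Carrier → Carrier
    -_ _⁻¹  : Carrier → Carrier
    0# 1#   : Carrier

    isCommutativeRing : IsCommutativeRing _≈_ _+_ _*_ -_ 0# 1#
    0≉1               : ¬ (0# ≈ 1#)
    ⁻¹-cong           : ∀ {x y} → x ≈ y → x ⁻¹ ≈ y ⁻¹
    *-inverse         : ∀ x → ¬ (x ≈ 0#) → x * x ⁻¹ ≈ 1#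

    isDecTotalOrder : IsDecTotalOrder _≈_ _≤_
    +-monoˡ-≤       : ∀ {x y} z → x ≤ y → x + z ≤ y + z
    *-nonNegative   : ∀ {x y} → 0# ≤ x → 0# ≤ y → 0# ≤ x * y

    complete : (P : Carrier → Set) → (∃[ x ] P x) →
               (∃[ b ] (∀ x → P x → x ≤ b)) →
               ∃[ s ] ((∀ x → P x → x ≤ s) ×
                       (∀ b → (∀ x → P x → x ≤ b) → s ≤ b))

  open IsDecTotalOrder isDecTotalOrder public using (_≟_; _≤?_)
  open Strict _≈_ _≤_ public using (_<_)

  commutativeRing : CommutativeRing 0ℓ 0ℓ
  commutativeRing = record { isCommutativeRing = isCommutativeRing }

  -- The sum of a finite family, Vector Carrier n = Fin n → Carrier.
  open RawMonoidSum (CommutativeRing.+-rawMonoid commutativeRing) public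
    using () renaming (sum to ∑)

-- The programming language: a real RAM with bounded loops and immutable
-- arrays.  A procedure is one closed piece of syntax for all input sizes.
-- Bounded loops lose no strongly polynomial procedure, since such a procedure
-- can be run for a precomputed polynomial number of steps.

data Ty : Set where
  bool nat real : Ty
  _⊗_           : Ty → Ty → Ty
  arr           : Ty → Ty

infixr 6 _⊗_

infixl 9 _!_
infixl 7 _*ᵣ_ _÷ᵣ_
infixl 6 _+ᵣ_ _-ᵣ_ _+ₙ_ _∸ₙ_
infix  4 _≤ᵣ_ _≤ₙ_

-- Naturals serve for counting and indexing; without a product on them, t steps
-- produce only naturals of O(t) bits more than the input sizes.
data Term (Γ : List Ty) : Ty → Set where
  var  : ∀ {τ} → τ ∈ Γ → Term Γ τ
  bind : ∀ {σ τ} → Term Γ σ → Term (σ ∷ Γ) τ → Term Γ τ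

  bit    : Bool → Term Γ bool
  if     : ∀ {τ} → Term Γ bool → Term Γ τ → Term Γ τ → Term Γ τ
  pair   : ∀ {σ τ} → Term Γ σ → Term Γ τ → Term Γ (σ ⊗ τ)
  first  : ∀ {σ τ} → Term Γ (σ ⊗ τ) → Term Γ σ
  second : ∀ {σ τ} → Term Γ (σ ⊗ τ) → Term Γ τ

  lit       : ℕ → Term Γ nat
  _+ₙ_ _∸ₙ_ : Term Γ nat → Term Γ nat → Term Γ nat
  _≤ₙ_      : Term Γ nat → Term Γ nat → Term Γ bool

  0ᵣ 1ᵣ               : Term Γ real
  _+ᵣ_ _-ᵣ_ _*ᵣ_ _÷ᵣ_ : Term Γ real → Term Γ real → Term Γ real
  _≤ᵣ_                : Term Γ real → Term Γ real → Term Γ bool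

  -- build n (λ i. e) is the array of the values of e for i = 0, …, n - 1.
  build : ∀ {τ} → Term Γ nat → Term (nat ∷ Γ) τ → Term Γ (arr τ)
  len   : ∀ {τ} → Term Γ (arr τ) → Term Γ nat
  _!_   : ∀ {τ} → Term Γ (arr τ) → Term Γ nat → Term Γ τ

  -- loop n x (λ s i. e) starts with s = x and performs s := e
  -- for i = 0, …, n - 1.
  loop  : ∀ {τ} → Term Γ nat → Term Γ τ → Term (τ ∷ nat ∷ Γ) τ → Term Γ τ

Program : Ty → Ty → Set
Program σ τ = Term (σ ∷ []) τ

iterate : {A : Set} → (A → ℕ → A) → A → ℕ → A
iterate f x zero    = x
iterate f x (suc i) = f (iterate f x i) i

lookupOr : {A : Set} → A → List A → ℕ → A
lookupOr d []       _       = d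
lookupOr d (x ∷ xs) zero    = x
lookupOr d (x ∷ xs) (suc i) = lookupOr d xs i

module Semantics (ℝ : Reals) where
  open Reals ℝ

  ⟦_⟧ : Ty → Set
  ⟦ bool ⟧  = Bool
  ⟦ nat ⟧   = ℕ
  ⟦ real ⟧  = Carrier
  ⟦ σ ⊗ τ ⟧ = ⟦ σ ⟧ × ⟦ τ ⟧
  ⟦ arr τ ⟧ = List ⟦ τ ⟧

  -- The result of reading an array out of bounds.
  default : ∀ τ → ⟦ τ ⟧
  default bool    = false
  default nat     = 0
  default real    = 0#
  default (σ ⊗ τ) = default σ , default τ
  default (arr τ) = []

  Env : List Ty → Set
  Env = All ⟦_⟧

  eval : ∀ {Γ τ} → Term Γ τ → Env Γ → ⟦ τ ⟧
  eval (var x)    ρ = All.lookup ρ x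
  eval (bind s t) ρ = eval t (eval s ρ ∷ ρ)
  eval (bit b)    ρ = b
  eval (if b s t) ρ = if eval b ρ then eval s ρ else eval t ρ
  eval (pair s t) ρ = eval s ρ , eval t ρ
  eval (first t)  ρ = proj₁ (eval t ρ)
  eval (second t) ρ = proj₂ (eval t ρ)
  eval (lit k)    ρ = k
  eval (s +ₙ t)   ρ = eval s ρ ℕ.+ eval t ρ
  eval (s ∸ₙ t)   ρ = eval s ρ ℕ.∸ eval t ρ
  eval (s ≤ₙ t)   ρ = eval s ρ ℕ.≤ᵇ eval t ρ
  eval 0ᵣ         ρ = 0#
  eval 1ᵣ         ρ = 1#
  eval (s +ᵣ t)   ρ = eval s ρ + eval t ρ
  eval (s -ᵣ t)   ρ = eval s ρ + - eval t ρ
  eval (s *ᵣ t)   ρ = eval s ρ * eval t ρ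
  eval (s ÷ᵣ t)   ρ = eval s ρ * eval t ρ ⁻¹
  eval (s ≤ᵣ t)   ρ = does (eval s ρ ≤? eval t ρ)
  eval (build n t)        ρ = applyUpTo (λ i → eval t (i ∷ ρ)) (eval n ρ)
  eval (len t)            ρ = length (eval t ρ)
  eval (_!_ {τ} s t)      ρ = lookupOr (default τ) (eval s ρ) (eval t ρ)
  eval (loop n x t)       ρ =
    iterate (λ s i → eval t (s ∷ i ∷ ρ)) (eval x ρ) (eval n ρ)

  -- The number of operations performed.  Everything is charged, not just the
  -- arithmetic on and comparisons of reals, so this also bounds the lengths of
  -- the arrays built; as the nesting of arrays is fixed by the types, the size
  -- of the output is then polynomially bounded, too.
  steps : ∀ {Γ τ} → Term Γ τ → Env Γ → ℕ
  steps (var x)    ρ = 1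
  steps (bind s t) ρ = 1 ℕ.+ steps s ρ ℕ.+ steps t (eval s ρ ∷ ρ)
  steps (bit b)    ρ = 1
  steps (if b s t) ρ =
    1 ℕ.+ steps b ρ ℕ.+ (if eval b ρ then steps s ρ else steps t ρ)
  steps (pair s t) ρ = 1 ℕ.+ steps s ρ ℕ.+ steps t ρ
  steps (first t)  ρ = 1 ℕ.+ steps t ρ
  steps (second t) ρ = 1 ℕ.+ steps t ρ
  steps (lit k)    ρ = 1
  steps (s +ₙ t)   ρ = 1 ℕ.+ steps s ρ ℕ.+ steps t ρ
  steps (s ∸ₙ t)   ρ = 1 ℕ.+ steps s ρ ℕ.+ steps t ρ
  steps (s ≤ₙ t)   ρ = 1 ℕ.+ steps s ρ ℕ.+ steps t ρ
  steps 0ᵣ         ρ = 1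
  steps 1ᵣ         ρ = 1
  steps (s +ᵣ t)   ρ = 1 ℕ.+ steps s ρ ℕ.+ steps t ρ
  steps (s -ᵣ t)   ρ = 1 ℕ.+ steps s ρ ℕ.+ steps t ρ
  steps (s *ᵣ t)   ρ = 1 ℕ.+ steps s ρ ℕ.+ steps t ρ
  steps (s ÷ᵣ t)   ρ = 1 ℕ.+ steps s ρ ℕ.+ steps t ρ
  steps (s ≤ᵣ t)   ρ = 1 ℕ.+ steps s ρ ℕ.+ steps t ρ
  steps (build n t)  ρ =
    1 ℕ.+ steps n ρ ℕ.+
    sum (applyUpTo (λ i → 1 ℕ.+ steps t (i ∷ ρ)) (eval n ρ))
  steps (len t)      ρ = 1 ℕ.+ steps t ρ
  steps (s ! t)      ρ = 1 ℕ.+ steps s ρ ℕ.+ steps t ρ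
  steps (loop {τ} n x t) ρ =
    1 ℕ.+ steps n ρ ℕ.+ steps x ρ ℕ.+
    sum (applyUpTo (λ i → 1 ℕ.+ steps t (state i ∷ i ∷ ρ)) (eval n ρ))
    where
    state : ℕ → ⟦ τ ⟧
    state = iterate (λ s i → eval t (s ∷ i ∷ ρ)) (eval x ρ)

data Player : Set where
  max min : Player

module StochasticGames (ℝ : Reals) where
  open Reals ℝ
  open Semantics ℝ public

  record Game : Set where
    field
      n       : ℕ
      owner   : Fin n → Player
      a       : Fin n → ℕ
      a≥1     : ∀ j → 1 ℕ.≤ a j
      r       : (j : Fin n) → Fin (a j) → Carrier
      p       : (j : Fin n) → Fin (a j) → Vector Carrier n
      0≤p     : ∀ j i k → 0# ≤ p j i k
      p≤1     : ∀ j i k → p j i k ≤ 1#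
      p-total : ∀ j i → ∑ (p j i) ≈ 1#
      γ       : Carrier
      0≤γ     : 0# ≤ γ
      γ<1     : γ < 1#

  open Game public

  states : Game → ℕ
  states G = n G

  actions : Game → ℕ
  actions G = sum (tabulate (a G))

  Binary : Game → Set
  Binary G = ∀ j → a G j ℕ.≤ 2

  _isMaxOf_ _isMinOf_ : ∀ {m} → Carrier → Vector Carrier m → Set
  x isMaxOf f = (∃[ i ] x ≈ f i) × (∀ i → f i ≤ x)
  x isMinOf f = (∃[ i ] x ≈ f i) × (∀ i → x ≤ f i)

  _isOptimal[_]_ : ∀ {m} → Carrier → Player → Vector Carrier m → Set
  x isOptimal[ max ] f = x isMaxOf f
  x isOptimal[ min ] f = x isMinOf f

  IsSolution : (G : Game) → Vector Carrier (n G) → Set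
  IsSolution G v = ∀ j → v j isOptimal[ owner G j ]
    (λ i → r G j i + γ G * ∑ (λ k → p G j i k * v k))

  -- A game as input or output of a program: the discount factor and, for every
  -- state, whether max controls it and the array of its actions, each given by
  -- its reward and its row of transition probabilities.
  actionTy stateTy gameTy : Ty
  actionTy = real ⊗ arr real
  stateTy  = bool ⊗ arr actionTy
  gameTy   = real ⊗ arr stateTy

  isMax : Player → Bool
  isMax max = true
  isMax min = false

  encode : Game → ⟦ gameTy ⟧
  encode G = γ G , tabulate (λ j →
    isMax (owner G j) , tabulate (λ i → r G j i , tabulate (p G j i)))

  -- A problem with instances I, where the instance x is presented as input x
  -- and is to be answered by output x, is solved by a procedure whose running
  -- time is bounded by a polynomial in the numbers of states and actions of
  -- game x.  (Every polynomial in N and M is at most c * (1 + N + M) ^ d for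
  -- some c and d.)
  record StronglyPolynomial {I : Set} (game : I → Game) (σ τ : Ty)
                            (input : I → ⟦ σ ⟧) (output : I → ⟦ τ ⟧) : Set where
    field
      program : Program σ τ
      correct : ∀ x → eval program (input x ∷ []) ≡ output x
      c d     : ℕ
      bound   : ∀ x → steps program (input x ∷ []) ℕ.≤
                      c ℕ.* (1 ℕ.+ states (game x) ℕ.+ actions (game x)) ℕ.^ d

  -- A game together with a solution of the game it is transformed to.
  SolvedImage : (Game → Game) → Set
  SolvedImage B = Σ[ G ∈ Game ] Σ[ w ∈ Vector Carrier (n (B G)) ] IsSolution (B G) w

  -- The transformed game need not be passed on: it can be recomputed.
  recoverInput : (B : Game → Game) → SolvedImage B → ⟦ gameTy ⊗ arr real ⟧
  recoverInput B (G , w , _) = encode G , tabulate w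

  recoverOutput : (B : Game → Game) →
                  ((G : Game) → Vector Carrier (n (B G)) → Vector Carrier (n G)) →
                  SolvedImage B → ⟦ arr real ⟧
  recoverOutput B f (G , w , _) = tabulate (f G w)

{-# OPTIONS --safe #-}
module Submission where

-- A state j with actions 0, …, a - 1 becomes a chain of states (j , i) with
-- i < a: the player either takes action i or moves on to (j , i + 1).  Moving on
-- costs a discount factor δ, so (j , i) is given the value
-- δ⁻ⁱ max { A i′ | i ≤ i′ < a }, where A i′ is the value of action i′ (with
-- min in place of max for the min player), and (j , 0) keeps the value of j.  The
-- reward of action i is thus multiplied by δ⁻ⁱ and its probabilities by
-- γ δ⁻ⁱ⁻¹; the missing probability leads to a sink of value 0.  This requires
-- γ ≤ δⁱ⁺¹, which holds for δ = 1 - (1 - γ) / (M + 2) with M the number of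
-- all actions, by Bernoulli's inequality.

open import Defs
open import Algebra.Bundles using (CommutativeRing)
import Algebra.Properties.CommutativeSemigroup as CommutativeSemigroupProperties
import Algebra.Properties.Monoid.Sum as MonoidSum
import Algebra.Properties.Ring as RingProperties
open import Data.Bool using (Bool; true; false; if_then_else_)
open import Data.Empty using (⊥-elim)
open import Data.Fin using (Fin; toℕ; fromℕ<; zero; suc; #_)
open import Data.Fin.Properties using (toℕ<n; toℕ-fromℕ<)
open import Data.List as List using (List; []; _∷_; length; tabulate; applyUpTo)
open import Data.List.Membership.Propositional using (_∈_)
open import Data.List.Membership.Propositional.Properties using (∈-lookup)
open import Data.List.Properties using (length-applyUpTo; length-tabulate; tabulate-cong)
open import Data.List.Relation.Unary.All as All using ([]; _∷_)
open import Data.List.Relation.Unary.Any using (here; there)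
open import Data.Nat as ℕ using (ℕ; zero; suc; z≤n; s≤s)
open import Data.Nat.ListAction using (sum)
import Data.Nat.Properties as ℕ
open import Data.Product using (Σ-syntax; ∃-syntax; _×_; _,_; proj₁; proj₂)
open import Data.Sum as Sum using (_⊎_; inj₁; inj₂)
open import Data.Unit using (⊤; tt)
open import Data.Vec.Functional using (Vector)
open import Function using (_∘_; id)
open import Relation.Binary using (tri<; tri≈; tri>)
open import Relation.Binary.Bundles using (Poset)
open import Relation.Binary.PropositionalEquality as ≡ using (_≡_)
import Relation.Binary.Reasoning.PartialOrder as PartialOrderReasoning
open import Relation.Binary.Structures using (IsDecTotalOrder)
open import Relation.Nullary using (¬_; yes; no)

-- All transitions of a game share one discount factor, so a move along a chain cannot be free.
-- Inflating level i by δ⁻ⁱ undoes the cost exactly, but the inflated weights must remain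
-- probabilities, and this is what forces δ close to 1 relative to the length of the chain.
--
-- All chains are padded to the common length M: the states (j , i) form a grid of N = M n states,
-- with (j , i) at index j + i n and the sink at index N. Level 0 is the initial segment, so
-- original rows only need padding by zeros, and the solution is read off as a prefix. Padding
-- states have a single worthless action into the sink.
--
-- The language neither multiplies or divides naturals nor converts them to reals; loops do this.
-- Sums and powers on the mathematical side are defined by the same iteration, so that the program
-- evaluates to the intended image by computation alone.

module _ {A : Set} (d : A) where

  lookupOr-tabulate : ∀ {n} (f : Fin n → A) i → lookupOr d (tabulate f) (toℕ i) ≡ f i
  lookupOr-tabulate f zero    = ≡.refl
  lookupOr-tabulate f (suc i) = lookupOr-tabulate (f ∘ suc) i

  lookupOr-applyUpTo : ∀ (f : ℕ → A) {n i} → i ℕ.< n → lookupOr d (applyUpTo f n) i ≡ f i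
  lookupOr-applyUpTo f {suc n} {zero}  _         = ≡.refl
  lookupOr-applyUpTo f {suc n} {suc i} (s≤s i<n) = lookupOr-applyUpTo (f ∘ suc) i<n

  lookupOr-beyond : ∀ (xs : List A) {i} → length xs ℕ.≤ i → lookupOr d xs i ≡ d
  lookupOr-beyond []       _         = ≡.refl
  lookupOr-beyond (x ∷ xs) (s≤s n≤i) = lookupOr-beyond xs n≤i

  lookupOr-applyUpTo-elim : (P : A → Set) → P d → ∀ f n → (∀ {i} → i ℕ.< n → P (f i)) →
                            ∀ i → P (lookupOr d (applyUpTo f n) i)
  lookupOr-applyUpTo-elim P pd f zero    h i       = pd
  lookupOr-applyUpTo-elim P pd f (suc n) h zero    = h (s≤s z≤n)
  lookupOr-applyUpTo-elim P pd f (suc n) h (suc i) =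
    lookupOr-applyUpTo-elim P pd (f ∘ suc) n (h ∘ s≤s) i

applyUpTo-toℕ : ∀ {A : Set} (f : ℕ → A) n → applyUpTo f n ≡ tabulate {n = n} (f ∘ toℕ)
applyUpTo-toℕ f zero    = ≡.refl
applyUpTo-toℕ f (suc n) = ≡.cong (f 0 ∷_) (applyUpTo-toℕ (f ∘ suc) n)

sum-applyUpTo-≤ : ∀ f n {b} → (∀ {i} → i ℕ.< n → f i ℕ.≤ b) → sum (applyUpTo f n) ℕ.≤ n ℕ.* b
sum-applyUpTo-≤ f zero    h = z≤n
sum-applyUpTo-≤ f (suc n) h = ℕ.+-mono-≤ (h (s≤s z≤n)) (sum-applyUpTo-≤ (f ∘ suc) n (h ∘ s≤s))

-- Polynomials and their domination by a single power.

infixl 6 _⊕_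
infixl 7 _⊛_
infixr 8 _⊙_

-- Syntax rather than functions, so that a coefficient and an exponent can be read off. Composition
-- is needed because the body of a binding runs in an environment that is itself only polynomially
-- bounded.
data Poly : Set where
  const   : ℕ → Poly
  X       : Poly
  _⊕_ _⊛_ : Poly → Poly → Poly
  _⊙_     : Poly → Poly → Poly

⟪_⟫ : Poly → ℕ → ℕ
⟪ const k ⟫ x = k
⟪ X ⟫       x = x
⟪ P ⊕ Q ⟫   x = ⟪ P ⟫ x ℕ.+ ⟪ Q ⟫ x
⟪ P ⊛ Q ⟫   x = ⟪ P ⟫ x ℕ.* ⟪ Q ⟫ x
⟪ P ⊙ Q ⟫   x = ⟪ P ⟫ (⟪ Q ⟫ x)

deg : Poly → ℕ
deg (const k) = 0
deg X         = 1
deg (P ⊕ Q)   = deg P ℕ.+ deg Q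
deg (P ⊛ Q)   = deg P ℕ.+ deg Q
deg (P ⊙ Q)   = deg Q ℕ.* deg P

coeff : Poly → ℕ
coeff (const k) = k
coeff X         = 1
coeff (P ⊕ Q)   = coeff P ℕ.+ coeff Q
coeff (P ⊛ Q)   = coeff P ℕ.* coeff Q
coeff (P ⊙ Q)   = coeff P ℕ.* suc (coeff Q) ℕ.^ deg P

^-distribʳ-* : ∀ m n o → (m ℕ.* n) ℕ.^ o ≡ m ℕ.^ o ℕ.* n ℕ.^ o
^-distribʳ-* m n zero    = ≡.refl
^-distribʳ-* m n (suc o) =
  ≡.trans (≡.cong (m ℕ.* n ℕ.*_) (^-distribʳ-* m n o)) (ℕ.[m*n]*[o*p]≡[m*o]*[n*p] m n _ _)

-- The base `suc x` is at least 1, so powers grow with the exponent and the degree of a sum may be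
-- overestimated by adding degrees. The shape is that of the bound in `StronglyPolynomial`.
⟪⟫-≤ : ∀ P x → ⟪ P ⟫ x ℕ.≤ coeff P ℕ.* suc x ℕ.^ deg P
⟪⟫-≤ (const k) x = ℕ.≤-reflexive (≡.sym (ℕ.*-identityʳ k))
⟪⟫-≤ X         x = ℕ.≤-trans (ℕ.n≤1+n x)
  (ℕ.≤-reflexive (≡.sym (≡.trans (ℕ.*-identityˡ _) (ℕ.*-identityʳ (suc x)))))
⟪⟫-≤ (P ⊕ Q)   x = begin
  ⟪ P ⟫ x ℕ.+ ⟪ Q ⟫ x
    ≤⟨ ℕ.+-mono-≤ (⟪⟫-≤ P x) (⟪⟫-≤ Q x) ⟩
  cP ℕ.* y ℕ.^ dP ℕ.+ cQ ℕ.* y ℕ.^ dQ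
    ≤⟨ ℕ.+-mono-≤ (ℕ.*-monoʳ-≤ cP (ℕ.^-monoʳ-≤ y (ℕ.m≤m+n dP dQ)))
                  (ℕ.*-monoʳ-≤ cQ (ℕ.^-monoʳ-≤ y (ℕ.m≤n+m dQ dP))) ⟩
  cP ℕ.* y ℕ.^ (dP ℕ.+ dQ) ℕ.+ cQ ℕ.* y ℕ.^ (dP ℕ.+ dQ)
    ≡⟨ ℕ.*-distribʳ-+ _ cP cQ ⟨
  (cP ℕ.+ cQ) ℕ.* y ℕ.^ (dP ℕ.+ dQ) ∎
  where
  open ℕ.≤-Reasoning
  y = suc x
  cP = coeff P
  cQ = coeff Q
  dP = deg P
  dQ = deg Q
⟪⟫-≤ (P ⊛ Q)   x = begin
  ⟪ P ⟫ x ℕ.* ⟪ Q ⟫ x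
    ≤⟨ ℕ.*-mono-≤ (⟪⟫-≤ P x) (⟪⟫-≤ Q x) ⟩
  (cP ℕ.* y ℕ.^ dP) ℕ.* (cQ ℕ.* y ℕ.^ dQ)
    ≡⟨ ℕ.[m*n]*[o*p]≡[m*o]*[n*p] cP (y ℕ.^ dP) cQ (y ℕ.^ dQ) ⟩
  cP ℕ.* cQ ℕ.* (y ℕ.^ dP ℕ.* y ℕ.^ dQ)
    ≡⟨ ≡.cong (cP ℕ.* cQ ℕ.*_) (ℕ.^-distribˡ-+-* y dP dQ) ⟨
  cP ℕ.* cQ ℕ.* y ℕ.^ (dP ℕ.+ dQ) ∎
  where
  open ℕ.≤-Reasoning
  y = suc x
  cP = coeff P
  cQ = coeff Q
  dP = deg P
  dQ = deg Q
⟪⟫-≤ (P ⊙ Q)   x = begin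
  ⟪ P ⟫ (⟪ Q ⟫ x)
    ≤⟨ ⟪⟫-≤ P _ ⟩
  coeff P ℕ.* suc (⟪ Q ⟫ x) ℕ.^ dP
    -- The successor is absorbed into the coefficient, since 1 ≤ y ^ dQ.
    ≤⟨ ℕ.*-monoʳ-≤ (coeff P) (ℕ.^-monoˡ-≤ dP
         (ℕ.+-mono-≤ (ℕ.m^n>0 y dQ) (⟪⟫-≤ Q x))) ⟩
  coeff P ℕ.* (suc (coeff Q) ℕ.* y ℕ.^ dQ) ℕ.^ dP
    ≡⟨ ≡.cong (coeff P ℕ.*_) (^-distribʳ-* (suc (coeff Q)) (y ℕ.^ dQ) dP) ⟩
  coeff P ℕ.* (suc (coeff Q) ℕ.^ dP ℕ.* (y ℕ.^ dQ) ℕ.^ dP)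
    ≡⟨ ≡.cong (λ z → coeff P ℕ.* (suc (coeff Q) ℕ.^ dP ℕ.* z)) (ℕ.^-*-assoc y dQ dP) ⟩
  coeff P ℕ.* (suc (coeff Q) ℕ.^ dP ℕ.* y ℕ.^ (dQ ℕ.* dP))
    ≡⟨ ℕ.*-assoc (coeff P) _ _ ⟨
  coeff P ℕ.* suc (coeff Q) ℕ.^ dP ℕ.* y ℕ.^ (dQ ℕ.* dP) ∎
  where
  open ℕ.≤-Reasoning
  y = suc x
  dP = deg P
  dQ = deg Q

-- Polynomial bounds on running time and on the size of values.

module Cost (ℝ : Reals) where
  open Semantics ℝ

  -- Only naturals and array lengths can make later loops longer; reals have unit size. Entries are
  -- bounded at every index, so that reading out of bounds needs no separate case.
  Bounded : ℕ → ∀ τ → ⟦ τ ⟧ → Set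
  Bounded x bool    _       = ⊤
  Bounded x nat     k       = k ℕ.≤ x
  Bounded x real    _       = ⊤
  Bounded x (σ ⊗ τ) (u , v) = Bounded x σ u × Bounded x τ v
  Bounded x (arr τ) us      = length us ℕ.≤ x × (∀ i → Bounded x τ (lookupOr (default τ) us i))

  Bounded-mono : ∀ {x y} τ {v} → x ℕ.≤ y → Bounded x τ v → Bounded y τ v
  Bounded-mono bool    x≤y b         = tt
  Bounded-mono nat     x≤y b         = ℕ.≤-trans b x≤y
  Bounded-mono real    x≤y b         = tt
  Bounded-mono (σ ⊗ τ) x≤y (b , b′)  = Bounded-mono σ x≤y b , Bounded-mono τ x≤y b′
  Bounded-mono (arr τ) x≤y (l , b)   = ℕ.≤-trans l x≤y , Bounded-mono τ x≤y ∘ b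

  Bounded-default : ∀ {x} τ → Bounded x τ (default τ)
  Bounded-default bool    = tt
  Bounded-default nat     = z≤n
  Bounded-default real    = tt
  Bounded-default (σ ⊗ τ) = Bounded-default σ , Bounded-default τ
  Bounded-default (arr τ) = z≤n , λ _ → Bounded-default τ

  Bounded-applyUpTo : ∀ {x} τ f n → n ℕ.≤ x → (∀ {i} → i ℕ.< n → Bounded x τ (f i)) →
                      Bounded x (arr τ) (applyUpTo f n)
  Bounded-applyUpTo τ f n n≤x h =
    ℕ.≤-trans (ℕ.≤-reflexive (length-applyUpTo f n)) n≤x ,
    lookupOr-applyUpTo-elim _ (Bounded _ τ) (Bounded-default τ) f n h

  Bounded-tabulate : ∀ {x} τ {n} (f : Fin n → ⟦ τ ⟧) → n ℕ.≤ x → (∀ i → Bounded x τ (f i)) →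
                     Bounded x (arr τ) (tabulate f)
  Bounded-tabulate {x} τ {n} f n≤x h =
    ℕ.≤-trans (ℕ.≤-reflexive (length-tabulate f)) n≤x , go f h
    where
    go : ∀ {n} (f : Fin n → ⟦ τ ⟧) → (∀ i → Bounded x τ (f i)) →
         ∀ i → Bounded x τ (lookupOr (default τ) (tabulate f) i)
    go {zero}  f h i       = Bounded-default τ
    go {suc n} f h zero    = h zero
    go {suc n} f h (suc i) = go (f ∘ suc) (h ∘ suc) i

  infixr 5 _∷_
  data BoundedEnv (x : ℕ) : ∀ {Γ} → Env Γ → Set where
    []  : BoundedEnv x []
    _∷_ : ∀ {Γ τ} {v : ⟦ τ ⟧} {ρ : Env Γ} →
          Bounded x τ v → BoundedEnv x ρ → BoundedEnv x {τ ∷ Γ} (v ∷ ρ)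

  Bounded-lookup : ∀ {x Γ τ} {ρ : Env Γ} → BoundedEnv x ρ → (y : τ ∈ Γ) →
                   Bounded x τ (All.lookup ρ y)
  Bounded-lookup (b ∷ bs) (here ≡.refl) = b
  Bounded-lookup (b ∷ bs) (there y)   = Bounded-lookup bs y

  BoundedEnv-mono : ∀ {x y Γ} {ρ : Env Γ} → x ℕ.≤ y → BoundedEnv x ρ → BoundedEnv y ρ
  BoundedEnv-mono x≤y []       = []
  BoundedEnv-mono x≤y (b ∷ bs) = Bounded-mono _ x≤y b ∷ BoundedEnv-mono x≤y bs

  -- Without a bound on the growth of the state, a loop could double a natural
  -- in each round.
  record Growth {Γ τ} (t : Term (τ ∷ nat ∷ Γ) τ) : Set where
    constructor _,_
    field
      rate    : Poly
      bounded : ∀ {x y} {ρ : Env Γ} {s i} →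
        BoundedEnv x ρ → i ℕ.≤ x → Bounded y τ s →
        Bounded (y ℕ.+ ⟪ rate ⟫ x) τ (eval t (s ∷ i ∷ ρ))
  open Growth

  -- Only loops carry a condition, so the evidence for a concrete program is mostly inferred.
  Tame : ∀ {Γ τ} → Term Γ τ → Set
  Tame (var y)      = ⊤
  Tame (bind s t)   = Tame s × Tame t
  Tame (bit b)      = ⊤
  Tame (if b s t)   = Tame b × Tame s × Tame t
  Tame (pair s t)   = Tame s × Tame t
  Tame (first t)    = Tame t
  Tame (second t)   = Tame t
  Tame (lit k)      = ⊤
  Tame (s +ₙ t)     = Tame s × Tame t
  Tame (s ∸ₙ t)     = Tame s × Tame t
  Tame (s ≤ₙ t)     = Tame s × Tame t
  Tame 0ᵣ           = ⊤
  Tame 1ᵣ           = ⊤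
  Tame (s +ᵣ t)     = Tame s × Tame t
  Tame (s -ᵣ t)     = Tame s × Tame t
  Tame (s *ᵣ t)     = Tame s × Tame t
  Tame (s ÷ᵣ t)     = Tame s × Tame t
  Tame (s ≤ᵣ t)     = Tame s × Tame t
  Tame (build n t)  = Tame n × Tame t
  Tame (len t)      = Tame t
  Tame (s ! t)      = Tame s × Tame t
  Tame (loop n u t) = Tame n × Tame u × Tame t × Growth t

  realGrowth : ∀ {Γ} {t : Term (real ∷ nat ∷ Γ) real} → Growth t
  realGrowth = const 0 , λ _ _ _ → tt

  -- One polynomial bounds both steps and values, because the steps of a term depend on the values
  -- of its subterms. Hence the summands `X` for a variable and `const k` for a literal, either of
  -- which takes only one step.
  cost : ∀ {Γ τ} (t : Term Γ τ) → Tame t → Poly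
  cost (var y)      _         = const 1 ⊕ X
  cost (bind s t)   (p , q)   = const 1 ⊕ cost s p ⊕ cost t q ⊙ (X ⊕ cost s p)
  cost (bit b)      _         = const 1
  cost (if b s t)   (p , q , r) = const 1 ⊕ cost b p ⊕ (cost s q ⊕ cost t r)
  cost (pair s t)   (p , q)   = const 1 ⊕ cost s p ⊕ cost t q
  cost (first t)    p         = const 1 ⊕ cost t p
  cost (second t)   p         = const 1 ⊕ cost t p
  cost (lit k)      _         = const 1 ⊕ const k
  cost (s +ₙ t)     (p , q)   = const 1 ⊕ cost s p ⊕ cost t q
  cost (s ∸ₙ t)     (p , q)   = const 1 ⊕ cost s p ⊕ cost t q
  cost (s ≤ₙ t)     (p , q)   = const 1 ⊕ cost s p ⊕ cost t q
  cost 0ᵣ           _         = const 1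
  cost 1ᵣ           _         = const 1
  cost (s +ᵣ t)     (p , q)   = const 1 ⊕ cost s p ⊕ cost t q
  cost (s -ᵣ t)     (p , q)   = const 1 ⊕ cost s p ⊕ cost t q
  cost (s *ᵣ t)     (p , q)   = const 1 ⊕ cost s p ⊕ cost t q
  cost (s ÷ᵣ t)     (p , q)   = const 1 ⊕ cost s p ⊕ cost t q
  cost (s ≤ᵣ t)     (p , q)   = const 1 ⊕ cost s p ⊕ cost t q
  cost (build n t)  (p , q)   =
    -- The product pays for the steps; the last summand bounds the entries of the array.
    const 1 ⊕ N ⊕ (N ⊛ (const 1 ⊕ cost t q ⊙ (X ⊕ N)) ⊕ cost t q ⊙ (X ⊕ N))
    where N = cost n p
  cost (len t)      p         = const 1 ⊕ cost t p
  cost (s ! t)      (p , q)   = const 1 ⊕ cost s p ⊕ cost t q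
  cost (loop n u t) (p , q , r , g) =
    const 1 ⊕ N ⊕ U ⊕ (S ⊕ N ⊛ (const 1 ⊕ cost t r ⊙ (X ⊕ N ⊕ S)))
    where
    N = cost n p
    U = cost u q
    -- A bound on the state in all rounds: the initial one plus at most N equal increments.
    S = U ⊕ N ⊛ rate g ⊙ (X ⊕ N)

  private
    2nd : ∀ a b → b ℕ.≤ suc a ℕ.+ b
    2nd a b = ℕ.m≤n+m b (suc a)

    1st : ∀ a b → a ℕ.≤ suc a ℕ.+ b
    1st a b = ℕ.m≤n⇒m≤1+n (ℕ.m≤m+n a b)

  mutual
    value-bound : ∀ {Γ τ} (t : Term Γ τ) (p : Tame t) {x} {ρ : Env Γ} →
                  BoundedEnv x ρ → Bounded (⟪ cost t p ⟫ x) τ (eval t ρ)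
    value-bound {τ = τ} (var y) _ bs = Bounded-mono τ (ℕ.n≤1+n _) (Bounded-lookup bs y)
    value-bound {τ = τ} (bind s t) (p , q) {x} bs =
      Bounded-mono τ (2nd (⟪ cost s p ⟫ x) _) (value-bound t q (bind-env s p bs))
    value-bound (bit b) _ bs = tt
    value-bound {τ = τ} (if b s t) (p , q , r) {x} {ρ} bs with eval b ρ
    ... | true  = Bounded-mono τ
      (ℕ.≤-trans (ℕ.m≤m+n _ (⟪ cost t r ⟫ x)) (2nd (⟪ cost b p ⟫ x) _)) (value-bound s q bs)
    ... | false = Bounded-mono τ
      (ℕ.≤-trans (ℕ.m≤n+m _ (⟪ cost s q ⟫ x)) (2nd (⟪ cost b p ⟫ x) _)) (value-bound t r bs)
    value-bound {τ = σ ⊗ τ} (pair s t) (p , q) {x} bs =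
      Bounded-mono σ (1st _ (⟪ cost t q ⟫ x)) (value-bound s p bs) ,
      Bounded-mono τ (2nd (⟪ cost s p ⟫ x) _) (value-bound t q bs)
    value-bound {τ = τ} (first t)  p bs = Bounded-mono τ (ℕ.n≤1+n _) (proj₁ (value-bound t p bs))
    value-bound {τ = τ} (second t) p bs = Bounded-mono τ (ℕ.n≤1+n _) (proj₂ (value-bound t p bs))
    value-bound (lit k) _ bs = ℕ.n≤1+n k
    value-bound (s +ₙ t) (p , q) bs =
      ℕ.m≤n⇒m≤1+n (ℕ.+-mono-≤ (value-bound s p bs) (value-bound t q bs))
    value-bound (s ∸ₙ t) (p , q) {ρ = ρ} bs =
      ℕ.≤-trans (ℕ.m∸n≤m (eval s ρ) (eval t ρ))
        (ℕ.≤-trans (value-bound s p bs) (1st _ _))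
    value-bound (s ≤ₙ t) _ bs = tt
    value-bound 0ᵣ       _ bs = tt
    value-bound 1ᵣ       _ bs = tt
    value-bound (s +ᵣ t) _ bs = tt
    value-bound (s -ᵣ t) _ bs = tt
    value-bound (s *ᵣ t) _ bs = tt
    value-bound (s ÷ᵣ t) _ bs = tt
    value-bound (s ≤ᵣ t) _ bs = tt
    value-bound {τ = arr τ} (build n t) (p , q) {x} bs =
      Bounded-applyUpTo τ _ _
        (ℕ.≤-trans (value-bound n p bs) (1st _ _))
        λ i<n → Bounded-mono τ
          (ℕ.≤-trans (ℕ.m≤n+m _ _) (2nd (⟪ cost n p ⟫ x) _))
          (value-bound t q (build-env n p bs i<n))
    value-bound (len t) p bs = ℕ.m≤n⇒m≤1+n (proj₁ (value-bound t p bs))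
    value-bound {τ = τ} (s ! t) (p , q) {x} {ρ} bs =
      Bounded-mono τ (1st _ (⟪ cost t q ⟫ x)) (proj₂ (value-bound s p bs) (eval t ρ))
    value-bound {τ = τ} (loop n u t) (p , q , r , g) {x} bs =
      Bounded-mono τ (ℕ.≤-trans (ℕ.m≤m+n _ _) (2nd (⟪ cost n p ⟫ x ℕ.+ ⟪ cost u q ⟫ x) _))
        (state-bound n u t p q g bs _ ℕ.≤-refl)

    bind-env : ∀ {Γ σ} (s : Term Γ σ) (p : Tame s) {x} {ρ : Env Γ} → BoundedEnv x ρ →
               BoundedEnv (x ℕ.+ ⟪ cost s p ⟫ x) {σ ∷ Γ} (eval s ρ ∷ ρ)
    bind-env {σ = σ} s p {x} bs =
      Bounded-mono σ (ℕ.m≤n+m _ x) (value-bound s p bs) ∷ BoundedEnv-mono (ℕ.m≤m+n x _) bs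

    build-env : ∀ {Γ} (n : Term Γ nat) (p : Tame n) {x} {ρ : Env Γ} → BoundedEnv x ρ →
                ∀ {i} → i ℕ.< eval n ρ → BoundedEnv (x ℕ.+ ⟪ cost n p ⟫ x) {nat ∷ Γ} (i ∷ ρ)
    build-env n p {x} bs i<n =
      ℕ.≤-trans (ℕ.≤-trans (ℕ.<⇒≤ i<n) (value-bound n p bs)) (ℕ.m≤n+m _ x) ∷
      BoundedEnv-mono (ℕ.m≤m+n x _) bs

    state-bound : ∀ {Γ τ} (n : Term Γ nat) (u : Term Γ τ) (t : Term (τ ∷ nat ∷ Γ) τ)
                  (p : Tame n) (q : Tame u) (g : Growth t) {x} {ρ : Env Γ} → BoundedEnv x ρ →
                  ∀ i → i ℕ.≤ eval n ρ →
                  Bounded (⟪ cost u q ⊕ cost n p ⊛ rate g ⊙ (X ⊕ cost n p) ⟫ x) τ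
                    (iterate (λ s i → eval t (s ∷ i ∷ ρ)) (eval u ρ) i)
    state-bound {τ = τ} n u t p q g {x} {ρ} bs i i≤n =
      Bounded-mono τ
        (ℕ.+-monoʳ-≤ (⟪ cost u q ⟫ x)
          (ℕ.*-monoˡ-≤ (⟪ rate g ⟫ y) (ℕ.≤-trans i≤n (value-bound n p bs))))
        (go i i≤n)
      where
      y = x ℕ.+ ⟪ cost n p ⟫ x
      go : ∀ i → i ℕ.≤ eval n ρ →
           Bounded (⟪ cost u q ⟫ x ℕ.+ i ℕ.* ⟪ rate g ⟫ y) τ
             (iterate (λ s i → eval t (s ∷ i ∷ ρ)) (eval u ρ) i)
      go zero    _   = Bounded-mono τ (ℕ.m≤m+n _ 0) (value-bound u q bs)
      go (suc i) i<n = Bounded-mono τ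
        (ℕ.≤-reflexive (≡.trans (ℕ.+-assoc (⟪ cost u q ⟫ x) _ _)
          (≡.cong (⟪ cost u q ⟫ x ℕ.+_) (ℕ.+-comm (i ℕ.* ⟪ rate g ⟫ y) _))))
        (bounded g (BoundedEnv-mono (ℕ.m≤m+n x _) bs)
          (ℕ.≤-trans (ℕ.≤-trans (ℕ.<⇒≤ i<n) (value-bound n p bs)) (ℕ.m≤n+m _ x))
          (go i (ℕ.<⇒≤ i<n)))

  steps-bound : ∀ {Γ τ} (t : Term Γ τ) (p : Tame t) {x} {ρ : Env Γ} →
                BoundedEnv x ρ → steps t ρ ℕ.≤ ⟪ cost t p ⟫ x
  private
    binary-steps : ∀ {Γ σ τ} (s : Term Γ σ) (t : Term Γ τ) (p : Tame s) (q : Tame t)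
                   {x} {ρ : Env Γ} →
                   BoundedEnv x ρ →
                   1 ℕ.+ steps s ρ ℕ.+ steps t ρ ℕ.≤ ⟪ const 1 ⊕ cost s p ⊕ cost t q ⟫ x
  steps-bound (var y) _ bs = s≤s z≤n
  steps-bound (bind s t) (p , q) bs =
    s≤s (ℕ.+-mono-≤ (steps-bound s p bs) (steps-bound t q (bind-env s p bs)))
  steps-bound (bit b) _ bs = ℕ.≤-refl
  steps-bound (if b s t) (p , q , r) {x} {ρ} bs =
    s≤s (ℕ.+-mono-≤ (steps-bound b p bs) (branches (eval b ρ)))
    where
    branches : ∀ c → (if c then steps s ρ else steps t ρ) ℕ.≤ ⟪ cost s q ⟫ x ℕ.+ ⟪ cost t r ⟫ x
    branches true  = ℕ.≤-trans (steps-bound s q bs) (ℕ.m≤m+n _ _)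
    branches false = ℕ.≤-trans (steps-bound t r bs) (ℕ.m≤n+m _ _)
  steps-bound (pair s t) (p , q) bs = binary-steps s t p q bs
  steps-bound (first t)  p bs = s≤s (steps-bound t p bs)
  steps-bound (second t) p bs = s≤s (steps-bound t p bs)
  steps-bound (lit k) _ bs = s≤s z≤n
  steps-bound (s +ₙ t) (p , q) bs = binary-steps s t p q bs
  steps-bound (s ∸ₙ t) (p , q) bs = binary-steps s t p q bs
  steps-bound (s ≤ₙ t) (p , q) bs = binary-steps s t p q bs
  steps-bound 0ᵣ _ bs = ℕ.≤-refl
  steps-bound 1ᵣ _ bs = ℕ.≤-refl
  steps-bound (s +ᵣ t) (p , q) bs = binary-steps s t p q bs
  steps-bound (s -ᵣ t) (p , q) bs = binary-steps s t p q bs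
  steps-bound (s *ᵣ t) (p , q) bs = binary-steps s t p q bs
  steps-bound (s ÷ᵣ t) (p , q) bs = binary-steps s t p q bs
  steps-bound (s ≤ᵣ t) (p , q) bs = binary-steps s t p q bs
  steps-bound (build n t) (p , q) {ρ = ρ} bs =
    s≤s (ℕ.+-mono-≤ (steps-bound n p bs)
      (ℕ.≤-trans (sum-applyUpTo-≤ _ (eval n ρ)
                   (λ i<n → s≤s (steps-bound t q (build-env n p bs i<n))))
        (ℕ.≤-trans (ℕ.*-monoˡ-≤ _ (value-bound n p bs)) (ℕ.m≤m+n _ _))))
  steps-bound (len t) p bs = s≤s (steps-bound t p bs)
  steps-bound (s ! t) (p , q) bs = binary-steps s t p q bs
  steps-bound {Γ} {τ} (loop n u t) (p , q , r , g) {x} {ρ} bs =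
    ℕ.+-mono-≤ (s≤s (ℕ.+-mono-≤ (steps-bound n p bs) (steps-bound u q bs)))
      (ℕ.≤-trans (sum-applyUpTo-≤ _ (eval n ρ) (λ i<n → s≤s (steps-bound t r (loop-env i<n))))
        (ℕ.≤-trans (ℕ.*-monoˡ-≤ _ (value-bound n p bs)) (ℕ.m≤n+m _ _)))
    where
    loop-env : ∀ {i} → i ℕ.< eval n ρ →
      BoundedEnv _ {τ ∷ nat ∷ Γ} (iterate (λ s i → eval t (s ∷ i ∷ ρ)) (eval u ρ) i ∷ i ∷ ρ)
    loop-env {i} i<n =
      Bounded-mono τ (ℕ.m≤n+m _ (x ℕ.+ ⟪ cost n p ⟫ x))
        (state-bound n u t p q g bs i (ℕ.<⇒≤ i<n)) ∷
      BoundedEnv-mono (ℕ.m≤m+n _ _) (build-env n p bs i<n)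
  binary-steps s t p q bs = s≤s (ℕ.+-mono-≤ (steps-bound s p bs) (steps-bound t q bs))

-- Ordered field arithmetic, finite sums, powers, and the new discount factor.

module OrderedField (ℝ : Reals) where
  open Reals ℝ
  open CommutativeRing commutativeRing
    using (ring; refl; sym; trans; +-cong; *-cong; +-congˡ; +-congʳ; *-congˡ; *-congʳ;
           +-comm; +-assoc; *-comm; *-assoc; +-identityˡ; +-identityʳ; *-identityˡ; *-identityʳ;
           distribˡ; distribʳ; zeroˡ; zeroʳ; -‿inverseˡ; -‿inverseʳ; -‿cong; reflexive;
           +-commutativeSemigroup; *-commutativeSemigroup) public
  open MonoidSum (CommutativeRing.+-monoid commutativeRing) using (sum-cong-≋)
  open RingProperties ring using (-‿distribˡ-*; -‿involutive) public
  open CommutativeSemigroupProperties +-commutativeSemigroup public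
    using () renaming (xy∙z≈xz∙y to +-xy∙z≈xz∙y)
  open CommutativeSemigroupProperties *-commutativeSemigroup public
    using () renaming (interchange to *-interchange; x∙yz≈y∙xz to *-x∙yz≈y∙xz;
                       xy∙z≈xz∙y to *-xy∙z≈xz∙y)
  open IsDecTotalOrder isDecTotalOrder public
    using (total; antisym; isPartialOrder; ≤-respˡ-≈; ≤-respʳ-≈)
    renaming (refl to ≤-refl; trans to ≤-trans; reflexive to ≤-reflexive)

  poset : Poset _ _ _
  poset = record { isPartialOrder = isPartialOrder }

  open PartialOrderReasoning poset public

  x+y-y≈x : ∀ x y → x + y + - y ≈ x
  x+y-y≈x x y = trans (+-assoc x y (- y)) (trans (+-congˡ (-‿inverseʳ y)) (+-identityʳ x))

  x-y+y≈x : ∀ x y → x + - y + y ≈ x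
  x-y+y≈x x y = trans (+-assoc x (- y) y) (trans (+-congˡ (-‿inverseˡ y)) (+-identityʳ x))

  x+[y-x]≈y : ∀ x y → x + (y + - x) ≈ y
  x+[y-x]≈y x y = trans (+-comm x _) (x-y+y≈x y x)

  +-monoʳ-≤ : ∀ {x y} z → x ≤ y → z + x ≤ z + y
  +-monoʳ-≤ {x} {y} z x≤y = begin
    z + x ≈⟨ +-comm z x ⟩
    x + z ≤⟨ +-monoˡ-≤ z x≤y ⟩
    y + z ≈⟨ +-comm y z ⟩
    z + y ∎

  +-cancelʳ-≤ : ∀ {x y} z → x + z ≤ y + z → x ≤ y
  +-cancelʳ-≤ {x} {y} z h = begin
    x           ≈⟨ x+y-y≈x x z ⟨
    x + z + - z ≤⟨ +-monoˡ-≤ (- z) h ⟩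
    y + z + - z ≈⟨ x+y-y≈x y z ⟩
    y           ∎

  0≤y⇒x≤x+y : ∀ {y} x → 0# ≤ y → x ≤ x + y
  0≤y⇒x≤x+y {y} x 0≤y = begin
    x      ≈⟨ +-identityʳ x ⟨
    x + 0# ≤⟨ +-monoʳ-≤ x 0≤y ⟩
    x + y  ∎

  +-nonNegative : ∀ {x y} → 0# ≤ x → 0# ≤ y → 0# ≤ x + y
  +-nonNegative 0≤x 0≤y = ≤-trans 0≤x (0≤y⇒x≤x+y _ 0≤y)

  x≤y⇒0≤y-x : ∀ {x y} → x ≤ y → 0# ≤ y + - x
  x≤y⇒0≤y-x {x} {y} x≤y = begin
    0#      ≈⟨ -‿inverseʳ x ⟨
    x + - x ≤⟨ +-monoˡ-≤ (- x) x≤y ⟩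
    y + - x ∎

  *-monoʳ-≤ : ∀ {x y} z → 0# ≤ z → x ≤ y → z * x ≤ z * y
  *-monoʳ-≤ {x} {y} z 0≤z x≤y = begin
    z * x                   ≤⟨ 0≤y⇒x≤x+y _ (*-nonNegative 0≤z (x≤y⇒0≤y-x x≤y)) ⟩
    z * x + z * (y + - x)   ≈⟨ distribˡ z x _ ⟨
    z * (x + (y + - x))     ≈⟨ *-congˡ (x+[y-x]≈y x y) ⟩
    z * y                   ∎

  *-monoˡ-≤ : ∀ {x y} z → 0# ≤ z → x ≤ y → x * z ≤ y * z
  *-monoˡ-≤ {x} {y} z 0≤z x≤y = begin
    x * z ≈⟨ *-comm x z ⟩
    z * x ≤⟨ *-monoʳ-≤ z 0≤z x≤y ⟩
    z * y ≈⟨ *-comm z y ⟩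
    y * z ∎

  -- If 1 ≤ 0, then -1 is nonnegative, and so is its square 1.
  0≤1 : 0# ≤ 1#
  0≤1 with total 0# 1#
  ... | inj₁ 0≤1 = 0≤1
  ... | inj₂ 1≤0 = begin
    0#            ≤⟨ *-nonNegative 0≤-1 0≤-1 ⟩
    - 1# * - 1#   ≈⟨ -‿distribˡ-* 1# (- 1#) ⟨
    - (1# * - 1#) ≈⟨ -‿cong (*-identityˡ (- 1#)) ⟩
    - - 1#        ≈⟨ -‿involutive 1# ⟩
    1#            ∎
    where
    0≤-1 : 0# ≤ - 1#
    0≤-1 = ≤-trans (x≤y⇒0≤y-x 1≤0) (≤-reflexive (+-identityˡ (- 1#)))

  1≰0 : ¬ (1# ≤ 0#)
  1≰0 1≤0 = 0≉1 (antisym 0≤1 1≤0)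

  1≤x⇒x≉0 : ∀ {x} → 1# ≤ x → ¬ (x ≈ 0#)
  1≤x⇒x≉0 1≤x x≈0 = 1≰0 (≤-trans 1≤x (≤-reflexive x≈0))

  0≤x⁻¹ : ∀ {x} → 0# ≤ x → ¬ (x ≈ 0#) → 0# ≤ x ⁻¹
  0≤x⁻¹ {x} 0≤x x≉0 with total 0# (x ⁻¹)
  ... | inj₁ h = h
  ... | inj₂ h = ⊥-elim (1≰0 (begin
    1#       ≈⟨ *-inverse x x≉0 ⟨
    x * x ⁻¹ ≤⟨ *-monoʳ-≤ x 0≤x h ⟩
    x * 0#   ≈⟨ zeroʳ x ⟩
    0#       ∎))

  x*y≉0 : ∀ {x y} → ¬ (x ≈ 0#) → ¬ (y ≈ 0#) → ¬ (x * y ≈ 0#)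
  x*y≉0 {x} {y} x≉0 y≉0 xy≈0 = y≉0 (begin-equality
    y              ≈⟨ *-identityˡ y ⟨
    1# * y         ≈⟨ *-congʳ (*-inverse x x≉0) ⟨
    x * x ⁻¹ * y   ≈⟨ *-xy∙z≈xz∙y x _ y ⟩
    x * y * x ⁻¹   ≈⟨ *-congʳ xy≈0 ⟩
    0# * x ⁻¹      ≈⟨ zeroˡ _ ⟩
    0#             ∎)

  x⁻¹≉0 : ∀ {x} → ¬ (x ≈ 0#) → ¬ (x ⁻¹ ≈ 0#)
  x⁻¹≉0 {x} x≉0 h = 0≉1 (begin-equality
    0#        ≈⟨ zeroʳ x ⟨
    x * 0#    ≈⟨ *-congˡ h ⟨
    x * x ⁻¹  ≈⟨ *-inverse x x≉0 ⟩
    1#        ∎)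

  -- A nonzero x could be cancelled from x = δ x. Applied to the sink, whose only action returns to
  -- it.
  fixed-by-contraction : ∀ {δ x} → ¬ (δ ≈ 1#) → x ≈ δ * x → x ≈ 0#
  fixed-by-contraction {δ} {x} δ≉1 x≈δx with x ≟ 0#
  ... | yes x≈0 = x≈0
  ... | no  x≉0 = ⊥-elim (δ≉1 (begin-equality
    δ                ≈⟨ *-identityʳ δ ⟨
    δ * 1#           ≈⟨ *-congˡ (*-inverse x x≉0) ⟨
    δ * (x * x ⁻¹)   ≈⟨ *-assoc δ x _ ⟨
    δ * x * x ⁻¹     ≈⟨ *-congʳ x≈δx ⟨
    x * x ⁻¹         ≈⟨ *-inverse x x≉0 ⟩
    1#               ∎))

  -- Accumulates from the left, as a loop of the program does, whereas `∑` associates to the right;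
  -- `∑≈Σ<` mediates.
  Σ< : ℕ → (ℕ → Carrier) → Carrier
  Σ< n f = iterate (λ s i → s + f i) 0# n

  Σ<-cong : ∀ n {f g} → (∀ {i} → i ℕ.< n → f i ≈ g i) → Σ< n f ≈ Σ< n g
  Σ<-cong zero    h = refl
  Σ<-cong (suc n) h = +-cong (Σ<-cong n (h ∘ ℕ.m≤n⇒m≤1+n)) (h ℕ.≤-refl)

  Σ<-shift : ∀ n f → Σ< (suc n) f ≈ f 0 + Σ< n (f ∘ suc)
  Σ<-shift zero    f = +-comm 0# (f 0)
  Σ<-shift (suc n) f = trans (+-congʳ (Σ<-shift n f)) (+-assoc (f 0) _ _)

  ∑≈Σ< : ∀ n (f : Vector Carrier n) g → (∀ i → f i ≈ g (toℕ i)) → ∑ f ≈ Σ< n g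
  ∑≈Σ< zero    f g h = refl
  ∑≈Σ< (suc n) f g h = trans (+-cong (h zero) (∑≈Σ< n (f ∘ suc) (g ∘ suc) (h ∘ suc)))
                               (sym (Σ<-shift n g))

  ∑-cong : ∀ n {f g : Vector Carrier n} → (∀ i → f i ≈ g i) → ∑ f ≈ ∑ g
  ∑-cong n = sum-cong-≋

  Σ<-*ˡ : ∀ n c f → Σ< n (λ i → c * f i) ≈ c * Σ< n f
  Σ<-*ˡ zero    c f = sym (zeroʳ c)
  Σ<-*ˡ (suc n) c f = trans (+-congʳ (Σ<-*ˡ n c f)) (sym (distribˡ c _ _))

  ∑-nonNegative : ∀ n {f : Vector Carrier n} → (∀ i → 0# ≤ f i) → 0# ≤ ∑ f
  ∑-nonNegative zero    h = ≤-refl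
  ∑-nonNegative (suc n) h = +-nonNegative (h zero) (∑-nonNegative n (h ∘ suc))

  ∑-≥-term : ∀ n {f : Vector Carrier n} → (∀ i → 0# ≤ f i) → ∀ i → f i ≤ ∑ f
  ∑-≥-term (suc n)     h zero    = 0≤y⇒x≤x+y _ (∑-nonNegative n (h ∘ suc))
  ∑-≥-term (suc n) {f} h (suc i) = begin
    f (suc i)            ≤⟨ ∑-≥-term n (h ∘ suc) i ⟩
    ∑ (f ∘ suc)          ≤⟨ 0≤y⇒x≤x+y _ (h zero) ⟩
    ∑ (f ∘ suc) + f zero ≈⟨ +-comm _ _ ⟩
    f zero + ∑ (f ∘ suc) ∎

  Σ<-zero : ∀ n {f} → (∀ {i} → i ℕ.< n → f i ≈ 0#) → Σ< n f ≈ 0#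
  Σ<-zero zero    h = refl
  Σ<-zero (suc n) h =
    trans (+-cong (Σ<-zero n (h ∘ ℕ.m≤n⇒m≤1+n)) (h ℕ.≤-refl)) (+-identityˡ 0#)

  Σ<-single : ∀ n {f i} → i ℕ.< n → (∀ {k} → ¬ (k ≡ i) → f k ≈ 0#) → Σ< n f ≈ f i
  Σ<-single (suc n) {f} {i} i<1+n h with ℕ.m≤n⇒m<n∨m≡n (ℕ.s≤s⁻¹ i<1+n)
  ... | inj₁ i<n    =
    trans (+-cong (Σ<-single n i<n h) (h (λ n≡i → ℕ.<⇒≢ i<n (≡.sym n≡i)))) (+-identityʳ _)
  ... | inj₂ ≡.refl =
    trans (+-congʳ (Σ<-zero n (λ k<n → h (ℕ.<⇒≢ k<n)))) (+-identityˡ _)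

  -- Lets an original row be summed over all N states, its missing entries being read as 0.
  Σ<-truncate : ∀ {m n f} → m ℕ.≤ n → (∀ {i} → m ℕ.≤ i → f i ≈ 0#) → Σ< n f ≈ Σ< m f
  Σ<-truncate {m} {n} {f} m≤n h = go (ℕ.≤⇒≤′ m≤n)
    where
    go : ∀ {n} → m ℕ.≤′ n → Σ< n f ≈ Σ< m f
    go ℕ.≤′-refl            = refl
    go (ℕ.≤′-step {n} m≤′n) =
      trans (+-cong (go m≤′n) (h (ℕ.≤′⇒≤ m≤′n))) (+-identityʳ _)

  pow : Carrier → ℕ → Carrier
  pow x n = iterate (λ y _ → y * x) 1# n

  pow-nonNegative : ∀ {x} n → 0# ≤ x → 0# ≤ pow x n
  pow-nonNegative zero    0≤x = 0≤1
  pow-nonNegative (suc n) 0≤x = *-nonNegative (pow-nonNegative n 0≤x) 0≤x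

  pow-inverse : ∀ {x y} n → x * y ≈ 1# → pow x n * pow y n ≈ 1#
  pow-inverse zero    h = *-identityˡ 1#
  pow-inverse {x} {y} (suc n) h = begin-equality
    pow x n * x * (pow y n * y)   ≈⟨ *-interchange _ x _ y ⟩
    pow x n * pow y n * (x * y)   ≈⟨ *-cong (pow-inverse n h) h ⟩
    1# * 1#                       ≈⟨ *-identityˡ 1# ⟩
    1#                            ∎

  -- The real number n + 1, in the form that a loop produces.
  1+ : ℕ → Carrier
  1+ n = iterate (λ y _ → y + 1#) 1# n

  1+-mono : ∀ {m n} → m ℕ.≤ n → 1+ m ≤ 1+ n
  1+-mono {m} m≤n = go (ℕ.≤⇒≤′ m≤n)
    where
    go : ∀ {n} → m ℕ.≤′ n → 1+ m ≤ 1+ n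
    go ℕ.≤′-refl        = ≤-refl
    go (ℕ.≤′-step m≤′n) = ≤-trans (go m≤′n) (0≤y⇒x≤x+y _ 0≤1)

  -- Induction: multiplying the hypothesis by δ gives an error term (n + 1) x δ, at most (n + 1) x
  -- by δ ≤ 1, and the x in 1 = δ + x supplies the next summand. The coefficient is n + 1 instead of
  -- n, a slack that the denominator of `slower` accommodates.
  bernoulli : ∀ {δ x} → 0# ≤ δ → 0# ≤ x → δ + x ≈ 1# → ∀ n → 1# ≤ pow δ n + 1+ n * x
  bernoulli {δ} {x} 0≤δ 0≤x δ+x≈1 zero    =
    0≤y⇒x≤x+y 1# (*-nonNegative 0≤1 0≤x)
  bernoulli {δ} {x} 0≤δ 0≤x δ+x≈1 (suc n) = begin
    1#                                  ≈⟨ δ+x≈1 ⟨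
    δ + x                               ≈⟨ +-congʳ (*-identityˡ δ) ⟨
    1# * δ + x                          ≤⟨ +-monoˡ-≤ x (*-monoˡ-≤ δ 0≤δ ih) ⟩
    (pow δ n + 1+ n * x) * δ + x        ≈⟨ +-congʳ (distribʳ δ _ _) ⟩
    pow δ n * δ + 1+ n * x * δ + x      ≤⟨ +-monoˡ-≤ x (+-monoʳ-≤ _ (*-monoʳ-≤ _ 0≤nx δ≤1)) ⟩
    pow δ n * δ + 1+ n * x * 1# + x     ≈⟨ +-assoc _ _ x ⟩
    pow δ n * δ + (1+ n * x * 1# + x)   ≈⟨ +-congˡ (+-cong (*-identityʳ _) (sym (*-identityˡ x))) ⟩
    pow δ n * δ + (1+ n * x + 1# * x)   ≈⟨ +-congˡ (distribʳ x _ _) ⟨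
    pow δ n * δ + (1+ n + 1#) * x       ∎
    where
    ih : 1# ≤ pow δ n + 1+ n * x
    ih = bernoulli 0≤δ 0≤x δ+x≈1 n
    0≤nx : 0# ≤ 1+ n * x
    0≤nx = *-nonNegative (≤-trans 0≤1 (1+-mono {n = n} z≤n)) 0≤x
    δ≤1 : δ ≤ 1#
    δ≤1 = ≤-trans (0≤y⇒x≤x+y δ 0≤x) (≤-reflexive δ+x≈1)

  slower : Carrier → ℕ → Carrier
  slower γ m = 1# + - ((1# + - γ) * (1+ m + 1#) ⁻¹)

  module _ {γ} (0≤γ : 0# ≤ γ) (γ<1 : γ < 1#) (m : ℕ) where
    private
      num = 1+ m + 1#
      x   = (1# + - γ) * num ⁻¹
      δ   = slower γ m

      1≤1+m : 1# ≤ 1+ m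
      1≤1+m = 1+-mono {n = m} z≤n

      0≤num : 0# ≤ num
      0≤num = +-nonNegative (≤-trans 0≤1 1≤1+m) 0≤1

      num≉0 : ¬ (num ≈ 0#)
      num≉0 = 1≤x⇒x≉0 (≤-trans 1≤1+m (0≤y⇒x≤x+y _ 0≤1))

      1-γ≉0 : ¬ (1# + - γ ≈ 0#)
      1-γ≉0 h = proj₂ γ<1 (begin-equality
        γ              ≈⟨ +-identityʳ γ ⟨
        γ + 0#         ≈⟨ +-congˡ h ⟨
        γ + (1# + - γ) ≈⟨ x+[y-x]≈y γ 1# ⟩
        1#             ∎)

      0≤x : 0# ≤ x
      0≤x = *-nonNegative (x≤y⇒0≤y-x (proj₁ γ<1)) (0≤x⁻¹ 0≤num num≉0)

      x≉0 : ¬ (x ≈ 0#)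
      x≉0 = x*y≉0 1-γ≉0 (x⁻¹≉0 num≉0)

      δ+x≈1 : δ + x ≈ 1#
      δ+x≈1 = x-y+y≈x 1# x

      num*x : num * x ≈ 1# + - γ
      num*x = begin-equality
        num * x                            ≈⟨ *-x∙yz≈y∙xz num _ _ ⟩
        (1# + - γ) * (num * num ⁻¹)        ≈⟨ *-congˡ (*-inverse num num≉0) ⟩
        (1# + - γ) * 1#                    ≈⟨ *-identityʳ _ ⟩
        1# + - γ                           ∎

      x≤1+m*x : x ≤ 1+ m * x
      x≤1+m*x = begin
        x        ≈⟨ *-identityˡ x ⟨
        1# * x   ≤⟨ *-monoˡ-≤ x 0≤x 1≤1+m ⟩
        1+ m * x ∎

      -- The denominator is at least 2, so 2 x ≤ 1 - γ ≤ 1 = δ + x. This keeps δ positive even for γ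
      -- = 0.
      x≤δ : x ≤ δ
      x≤δ = +-cancelʳ-≤ x (begin
        x + x               ≤⟨ +-monoˡ-≤ x x≤1+m*x ⟩
        1+ m * x + x        ≈⟨ +-congˡ (*-identityˡ x) ⟨
        1+ m * x + 1# * x   ≈⟨ distribʳ x _ _ ⟨
        num * x             ≈⟨ num*x ⟩
        1# + - γ            ≤⟨ 0≤y⇒x≤x+y _ 0≤γ ⟩
        1# + - γ + γ        ≈⟨ x-y+y≈x 1# γ ⟩
        1#                  ≈⟨ δ+x≈1 ⟨
        δ + x               ∎)

    slower-nonNegative : 0# ≤ δ
    slower-nonNegative = ≤-trans 0≤x x≤δ

    slower≉0 : ¬ (δ ≈ 0#)
    slower≉0 δ≈0 = x≉0 (antisym (≤-trans x≤δ (≤-reflexive δ≈0)) 0≤x)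

    slower<1 : δ < 1#
    slower<1 = ≤-trans (0≤y⇒x≤x+y δ 0≤x) (≤-reflexive δ+x≈1) , λ δ≈1 → x≉0 (begin-equality
      x              ≈⟨ +-identityˡ x ⟨
      0# + x         ≈⟨ +-congʳ (-‿inverseʳ δ) ⟨
      δ + - δ + x    ≈⟨ +-xy∙z≈xz∙y δ (- δ) x ⟩
      δ + x + - δ    ≈⟨ +-cong δ+x≈1 (-‿cong δ≈1) ⟩
      1# + - 1#      ≈⟨ -‿inverseʳ 1# ⟩
      0#             ∎)

    -- By Bernoulli the loss 1 - δⁿ is at most (n + 1) x, and (m + 2) x = 1 - γ.
    γ≤pow-slower : ∀ {n} → n ℕ.≤ m → γ ≤ pow δ n
    γ≤pow-slower {n} n≤m = +-cancelʳ-≤ (1# + - γ) (begin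
      γ + (1# + - γ)         ≈⟨ x+[y-x]≈y γ 1# ⟩
      1#                     ≤⟨ bernoulli slower-nonNegative 0≤x δ+x≈1 n ⟩
      pow δ n + 1+ n * x     ≤⟨ +-monoʳ-≤ _ (*-monoˡ-≤ x 0≤x 1+n≤num) ⟩
      pow δ n + num * x      ≈⟨ +-congˡ num*x ⟩
      pow δ n + (1# + - γ)   ∎)
      where
      1+n≤num : 1+ n ≤ num
      1+n≤num = ≤-trans (1+-mono n≤m) (0≤y⇒x≤x+y _ 0≤1)

    slower-inverse : δ * δ ⁻¹ ≈ 1#
    slower-inverse = *-inverse δ slower≉0

    0≤slower⁻¹ : 0# ≤ δ ⁻¹
    0≤slower⁻¹ = 0≤x⁻¹ slower-nonNegative slower≉0

    -- For n = i + 1 the left side is the total probability with which the rescaled action i reaches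
    -- original states.
    γ*pow-slower⁻¹≤1 : ∀ {n} → n ℕ.≤ m → γ * pow (δ ⁻¹) n ≤ 1#
    γ*pow-slower⁻¹≤1 {n} n≤m = begin
      γ * pow (δ ⁻¹) n         ≤⟨ *-monoˡ-≤ _ (pow-nonNegative n 0≤slower⁻¹) (γ≤pow-slower n≤m) ⟩
      pow δ n * pow (δ ⁻¹) n   ≈⟨ pow-inverse n slower-inverse ⟩
      1#                       ∎

-- Optima for both players and along a chain.

module Optima (ℝ : Reals) where
  open Reals ℝ
  open OrderedField ℝ
  open StochasticGames ℝ

  -- The preference order of a player, so that one argument serves both max and min.
  _⊑[_]_ : Carrier → Player → Carrier → Set
  x ⊑[ max ] y = x ≤ y
  x ⊑[ min ] y = y ≤ x

  ⊑-refl : ∀ o {x} → x ⊑[ o ] x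
  ⊑-refl max = ≤-refl
  ⊑-refl min = ≤-refl

  ⊑-trans : ∀ o {x y z} → x ⊑[ o ] y → y ⊑[ o ] z → x ⊑[ o ] z
  ⊑-trans max p q = ≤-trans p q
  ⊑-trans min p q = ≤-trans q p

  ⊑-resp : ∀ o {x x′ y y′} → x ≈ x′ → y ≈ y′ → x ⊑[ o ] y → x′ ⊑[ o ] y′
  ⊑-resp max p q h = ≤-respʳ-≈ q (≤-respˡ-≈ p h)
  ⊑-resp min p q h = ≤-respʳ-≈ p (≤-respˡ-≈ q h)

  ⊑-scale : ∀ o {x y} z → 0# ≤ z → x ⊑[ o ] y → (z * x) ⊑[ o ] (z * y)
  ⊑-scale max = *-monoʳ-≤
  ⊑-scale min = *-monoʳ-≤

  optimal : ∀ o {m x} {f : Vector Carrier m} →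
            (∃[ i ] x ≈ f i) → (∀ i → f i ⊑[ o ] x) → x isOptimal[ o ] f
  optimal max = _,_
  optimal min = _,_

  attained : ∀ o {m x} {f : Vector Carrier m} → x isOptimal[ o ] f → ∃[ i ] x ≈ f i
  attained max = proj₁
  attained min = proj₁

  extremal : ∀ o {m x} {f : Vector Carrier m} → x isOptimal[ o ] f → ∀ i → f i ⊑[ o ] x
  extremal max = proj₂
  extremal min = proj₂

  optimal-resp : ∀ o {m x y} {f : Vector Carrier m} → x ≈ y →
                 x isOptimal[ o ] f → y isOptimal[ o ] f
  optimal-resp o x≈y h with attained o h
  ... | i , x≈f = optimal o (i , trans (sym x≈y) x≈f) λ i → ⊑-resp o refl x≈y (extremal o h i)

  _isOptimal₂[_]_,_ : Carrier → Player → Carrier → Carrier → Set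
  x isOptimal₂[ o ] y , z = (x ≈ y ⊎ x ≈ z) × y ⊑[ o ] x × z ⊑[ o ] x

  -- The number of actions of a binary state is a conditional that does not reduce. An equation on m
  -- can be matched instead, and g describes the payoffs independently of m.
  optimal-of-1 : ∀ o {m x} {f : Vector Carrier m} {g : ℕ → Carrier} → m ≡ 1 →
                 (∀ i → f i ≈ g (toℕ i)) → x isOptimal[ o ] f → x ≈ g 0
  optimal-of-1 o ≡.refl f≈g h with attained o h
  ... | zero , x≈ = trans x≈ (f≈g zero)

  optimal-of-2 : ∀ o {m x} {f : Vector Carrier m} {g : ℕ → Carrier} → m ≡ 2 →
                 (∀ i → f i ≈ g (toℕ i)) → x isOptimal[ o ] f → x isOptimal₂[ o ] g 0 , g 1
  optimal-of-2 o ≡.refl f≈g h =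
    which (attained o h) ,
    ⊑-resp o (f≈g zero) refl (extremal o h zero) ,
    ⊑-resp o (f≈g (suc zero)) refl (extremal o h (suc zero))
    where
    which : _ → _
    which (zero     , x≈) = inj₁ (trans x≈ (f≈g zero))
    which (suc zero , x≈) = inj₂ (trans x≈ (f≈g (suc zero)))

  optimal₂-scale : ∀ o {x y z y′ z′} c → 0# ≤ c → c * y ≈ y′ → c * z ≈ z′ →
                   x isOptimal₂[ o ] y , z → (c * x) isOptimal₂[ o ] y′ , z′
  optimal₂-scale o c 0≤c cy cz (x≈ , y⊑ , z⊑) =
    Sum.map (λ h → trans (*-congˡ h) cy) (λ h → trans (*-congˡ h) cz) x≈ ,
    ⊑-resp o cy refl (⊑-scale o c 0≤c y⊑) ,
    ⊑-resp o cz refl (⊑-scale o c 0≤c z⊑)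

  -- Peels off the first state of the chain: by induction u 1 is optimal among the remaining
  -- actions, and u 0 is the better of A 0 and u 1. The discounts have to be scaled away beforehand.
  optimal-of-chain : ∀ o m (f : Vector Carrier m) (A u : ℕ → Carrier) →
    1 ℕ.≤ m → (∀ i → f i ≈ A (toℕ i)) →
    (∀ {i} → suc i ℕ.< m → u i isOptimal₂[ o ] A i , u (suc i)) →
    (∀ {i} → suc i ≡ m → u i ≈ A i) →
    u 0 isOptimal[ o ] f
  optimal-of-chain o (suc zero)    f A u _ f≈A step last =
    optimal o (zero , trans (last ≡.refl) (sym (f≈A zero))) all
    where
    all : ∀ i → f i ⊑[ o ] u 0
    all zero = ⊑-resp o (trans (last ≡.refl) (sym (f≈A zero))) refl (⊑-refl o)
  optimal-of-chain o (suc (suc m)) f A u _ f≈A step last =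
    prepend (optimal-of-chain o (suc m) (f ∘ suc) (A ∘ suc) (u ∘ suc) (s≤s z≤n) (f≈A ∘ suc)
               (step ∘ s≤s) (last ∘ ≡.cong suc))
    where
    step₀ : u 0 isOptimal₂[ o ] A 0 , u 1
    step₀ = step (s≤s (s≤s z≤n))
    prepend : u 1 isOptimal[ o ] (f ∘ suc) → u 0 isOptimal[ o ] f
    prepend rest = optimal o (which (proj₁ step₀)) all
      where
      which : _ → ∃[ i ] u 0 ≈ f i
      which (inj₁ u≈A) = zero , trans u≈A (sym (f≈A zero))
      which (inj₂ u≈u) with attained o rest
      ... | i , u≈f = suc i , trans u≈u u≈f
      all : ∀ i → f i ⊑[ o ] u 0
      all zero    = ⊑-resp o (sym (f≈A zero)) refl (proj₁ (proj₂ step₀))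
      all (suc i) = ⊑-trans o (extremal o rest i) (proj₂ (proj₂ step₀))

-- Conditionals, array indices and the numbering of chain states.

module _ {A : Set} {x y : A} where

  if-≤ : ∀ {m n} → m ℕ.≤ n → (if m ℕ.≤ᵇ n then x else y) ≡ x
  if-≤ {m} {n} m≤n with m ℕ.≤ᵇ n | ℕ.≤⇒≤ᵇ m≤n
  ... | true | _ = ≡.refl

  if-> : ∀ {m n} → n ℕ.< m → (if m ℕ.≤ᵇ n then x else y) ≡ y
  if-> {m} {n} n<m with m ℕ.≤ᵇ n | ℕ.≤ᵇ⇒≤ m n
  ... | true  | m≤n = ⊥-elim (ℕ.<⇒≱ n<m (m≤n tt))
  ... | false | _   = ≡.refl

  if-elim : ∀ (P : A → Set) b → P x → P y → P (if b then x else y)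
  if-elim P true  px py = px
  if-elim P false px py = py

lookupOr-tabulate-view : ∀ {A : Set} (d : A) {n} (f : Fin n → A) i →
  (∃[ j ] i ≡ toℕ j × lookupOr d (tabulate f) i ≡ f j) ⊎ lookupOr d (tabulate f) i ≡ d
lookupOr-tabulate-view d {zero}  f i       = inj₂ ≡.refl
lookupOr-tabulate-view d {suc n} f zero    = inj₁ (zero , ≡.refl , ≡.refl)
lookupOr-tabulate-view d {suc n} f (suc i) with lookupOr-tabulate-view d (f ∘ suc) i
... | inj₁ (j , ≡.refl , eq) = inj₁ (suc j , ≡.refl , eq)
... | inj₂ eq                = inj₂ eq

iterate-+-≥ : ∀ (g : ℕ → ℕ) n {j} → j ℕ.< n → g j ℕ.≤ iterate (λ m j → m ℕ.+ g j) 0 n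
iterate-+-≥ g (suc n) {j} j<1+n with ℕ.m≤n⇒m<n∨m≡n (ℕ.s≤s⁻¹ j<1+n)
... | inj₁ j<n    = ℕ.m≤n⇒m≤n+o (g n) (iterate-+-≥ g n j<n)
... | inj₂ ≡.refl = ℕ.m≤n+m (g n) _

iterate-+-const : ∀ k n → iterate (λ s _ → s ℕ.+ k) 0 n ≡ n ℕ.* k
iterate-+-const k zero    = ≡.refl
iterate-+-const k (suc n) = ≡.trans (≡.cong (ℕ._+ k) (iterate-+-const k n)) (ℕ.+-comm (n ℕ.* k) k)

term-≤-sum : ∀ {n} (f : Fin n → ℕ) i → f i ℕ.≤ sum (tabulate f)
term-≤-sum f zero    = ℕ.m≤m+n (f zero) _
term-≤-sum f (suc i) = ℕ.m≤n⇒m≤o+n (f zero) (term-≤-sum (f ∘ suc) i)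

advance : ℕ → ℕ × ℕ → ℕ × ℕ
advance n (i , j) = if n ℕ.≤ᵇ suc j then (suc i , 0) else (i , suc j)

-- State j + i n of the binary game, where j < n, is the state (j , i); counting up
-- computes (i , j) without a division of naturals.
position : ℕ → ℕ → ℕ × ℕ
position n s = iterate (λ ij _ → advance n ij) (0 , 0) s

position-correct : ∀ {n} i {j} → j ℕ.< n → position n (j ℕ.+ i ℕ.* n) ≡ (i , j)
position-correct     zero    {zero}  _     = ≡.refl
-- The predecessor is the last state of the previous level, where `advance` carries.
position-correct {suc n} (suc i) {zero}  _ =
  ≡.trans (≡.cong (advance (suc n)) (position-correct i {n} ℕ.≤-refl)) (if-≤ (ℕ.≤-refl {suc n}))
position-correct {n} i {suc j} j<n =
  ≡.trans (≡.cong (advance n) (position-correct i (ℕ.<-trans ℕ.≤-refl j<n))) (if-> j<n)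

v : ∀ {Γ} (i : Fin (length Γ)) → Term Γ (List.lookup Γ i)
v i = var (∈-lookup i)

-- The two programs, and the growth of the states of their loops.

module Programs (ℝ : Reals) where
  open StochasticGames ℝ
  open Cost ℝ

  totalActionsT : Term (gameTy ∷ []) nat
  totalActionsT =
    loop (len (second (v (# 0)))) (lit 0) (v (# 0) +ₙ len (second (second (v (# 2)) ! v (# 1))))

  -- The product M n by repeated addition.
  sizeT : Term (nat ∷ gameTy ∷ []) nat
  sizeT = loop (v (# 0)) (lit 0) (v (# 0) +ₙ len (second (v (# 3))))

  discountT : Term (nat ∷ nat ∷ gameTy ∷ []) real
  discountT =
    1ᵣ -ᵣ (1ᵣ -ᵣ first (v (# 2))) ÷ᵣ (loop (v (# 1)) 1ᵣ (v (# 0) +ᵣ 1ᵣ) +ᵣ 1ᵣ)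

  Γ₀ : List Ty
  Γ₀ = real ∷ nat ∷ nat ∷ gameTy ∷ []

  wrapsT : Term (nat ⊗ nat ∷ nat ∷ nat ∷ Γ₀) bool
  wrapsT = len (second (v (# 6))) ≤ₙ lit 1 +ₙ second (v (# 0))

  positionT : Term (nat ∷ Γ₀) (nat ⊗ nat)
  positionT = loop (v (# 0)) (pair (lit 0) (lit 0))
    (if wrapsT
        (pair (lit 1 +ₙ first (v (# 0))) (lit 0))
        (pair (first (v (# 0))) (lit 1 +ₙ second (v (# 0)))))

  scaleT : Term (stateTy ∷ nat ⊗ nat ∷ nat ∷ Γ₀) real
  scaleT = loop (first (v (# 1))) 1ᵣ (v (# 0) ÷ᵣ v (# 5))

  countT : Term (real ∷ stateTy ∷ nat ⊗ nat ∷ nat ∷ Γ₀) nat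
  countT = if (lit 2 +ₙ first (v (# 2)) ≤ₙ len (second (v (# 1)))) (lit 2) (lit 1)

  Γ₁ : List Ty
  Γ₁ = actionTy ∷ nat ∷ real ∷ stateTy ∷ nat ⊗ nat ∷ nat ∷ Γ₀

  -- Action 0 takes the original action; action 1 moves on by one level, which is n indices further.
  -- Equality with that index takes two comparisons.
  weightT : Term (nat ∷ Γ₁) real
  weightT = if (v (# 2) ≤ₙ lit 0)
    (first (v (# 10)) *ᵣ (v (# 3) ÷ᵣ v (# 7)) *ᵣ (second (v (# 1)) ! v (# 0)))
    (if (v (# 0) ≤ₙ next) (if (next ≤ₙ v (# 0)) 1ᵣ 0ᵣ) 0ᵣ)
    where
    next : Term (nat ∷ Γ₁) nat
    next = v (# 6) +ₙ len (second (v (# 10)))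

  -- The sink, at index N, receives the probability that the first N entries leave over.
  entryT : Term (nat ∷ arr real ∷ Γ₁) real
  entryT = if (lit 1 +ₙ v (# 0) ≤ₙ v (# 9)) (v (# 1) ! v (# 0))
    (1ᵣ -ᵣ loop (v (# 9)) 0ᵣ (v (# 0) +ᵣ v (# 3) ! v (# 1)))

  actionT : Term Γ₁ actionTy
  actionT = pair (if (v (# 1) ≤ₙ lit 0) (first (v (# 0)) *ᵣ v (# 2)) 0ᵣ)
    (bind (build (v (# 7)) weightT) (build (lit 1 +ₙ v (# 8)) entryT))

  stateT : Term (nat ∷ Γ₀) stateTy
  stateT =
    bind positionT
    (bind (second (v (# 5)) ! second (v (# 0)))
    (bind scaleT
    (pair (first (v (# 1)))
          (build countT (bind (second (v (# 2)) ! first (v (# 3))) actionT)))))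

  binaryProgram : Program gameTy gameTy
  binaryProgram =
    bind totalActionsT (bind sizeT (bind discountT
    (pair (v (# 0)) (build (lit 1 +ₙ v (# 1)) stateT))))

  recoverProgram : Program (gameTy ⊗ arr real) (arr real)
  recoverProgram = build (len (second (first (v (# 0))))) (second (v (# 1)) ! v (# 0))

  -- Neither component rises by more than one in a round.
  positionT-tame : Tame positionT
  positionT-tame = _ , _ , _ , const 1 , λ {_} {y} {ρ} {s} {i} _ _ (q≤y , r≤y) →
    Bounded-mono (nat ⊗ nat) (ℕ.≤-reflexive (ℕ.+-comm 1 y))
      (if-elim (Bounded (suc y) (nat ⊗ nat)) (eval wrapsT (s ∷ i ∷ ρ))
        (s≤s q≤y , z≤n) (ℕ.m≤n⇒m≤1+n q≤y , s≤s r≤y))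

  stateT-tame : Tame stateT
  stateT-tame =
    positionT-tame , _ ,
    (_ , _ , _ , realGrowth) ,
    _ , _ , _ , _ , _ , _ , _ , _ , _ , _ , _ , _ , realGrowth

  binaryProgram-tame : Tame binaryProgram
  binaryProgram-tame =
    -- Here and in the next loop a round adds the length of an array of the input, hence the rate
    -- `X`.
    (_ , _ , _ , X , λ { (b ∷ []) _ s≤y → ℕ.+-mono-≤ s≤y (proj₁ (proj₂ (proj₂ (proj₂ b) _))) }) ,
    (_ , _ , _ , X , λ { (_ ∷ b ∷ []) _ s≤y → ℕ.+-mono-≤ s≤y (proj₁ (proj₂ b)) }) ,
    (_ , _ , (_ , _ , _ , realGrowth) , _) ,
    _ , _ , stateT-tame

-- The output of the program, as mathematical functions.

module Image (ℝ : Reals) where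
  open Reals ℝ
  open StochasticGames ℝ
  open OrderedField ℝ
  open Optima ℝ

  toPlayer : Bool → Player
  toPlayer b = if b then max else min

  isMax-toPlayer : ∀ b → isMax (toPlayer b) ≡ b
  isMax-toPlayer true  = ≡.refl
  isMax-toPlayer false = ≡.refl

  toPlayer-isMax : ∀ o → toPlayer (isMax o) ≡ o
  toPlayer-isMax max = ≡.refl
  toPlayer-isMax min = ≡.refl

  -- Goes through an array because the program does, which keeps `image` definitionally equal to the
  -- evaluated program.
  withSink : ℕ → (ℕ → Carrier) → ℕ → Carrier
  withSink N e k = if suc k ℕ.≤ᵇ N then row k else 1# + - Σ< N row
    where
    row : ℕ → Carrier
    row = lookupOr 0# (applyUpTo e N)

  withSink-inside : ∀ {N} e {k} → k ℕ.< N → withSink N e k ≡ e k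
  withSink-inside e k<N = ≡.trans (if-≤ k<N) (lookupOr-applyUpTo 0# e k<N)

  withSink-sink : ∀ N e → withSink N e N ≈ 1# + - Σ< N e
  withSink-sink N e = trans (reflexive (if-> (ℕ.≤-refl {suc N})))
    (+-congˡ (-‿cong (Σ<-cong N (λ k<N → reflexive (lookupOr-applyUpTo 0# e k<N)))))

  ∑-withSink : ∀ N e → ∑ {suc N} (withSink N e ∘ toℕ) ≈ 1#
  ∑-withSink N e = begin-equality
    ∑ {suc N} (withSink N e ∘ toℕ)        ≈⟨ ∑≈Σ< (suc N) _ (withSink N e) (λ _ → refl) ⟩
    Σ< N (withSink N e) + withSink N e N  ≈⟨ +-cong inside (withSink-sink N e) ⟩
    Σ< N e + (1# + - Σ< N e)              ≈⟨ x+[y-x]≈y _ 1# ⟩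
    1#                                    ∎
    where
    inside : Σ< N (withSink N e) ≈ Σ< N e
    inside = Σ<-cong N (reflexive ∘ withSink-inside e)

  ∑-withSink-* : ∀ N e (w : Vector Carrier (suc N)) (w′ : ℕ → Carrier) →
    (∀ k → w k ≈ w′ (toℕ k)) →
    ∑ (λ k → withSink N e (toℕ k) * w k) ≈ Σ< N (λ k → e k * w′ k) + withSink N e N * w′ N
  ∑-withSink-* N e w w′ h =
    trans (∑≈Σ< (suc N) _ (λ k → withSink N e k * w′ k) (λ k → *-congˡ (h k)))
          (+-congʳ (Σ<-cong N (λ k<N → *-congʳ (reflexive (withSink-inside e k<N)))))

  withSink-nonNegative : ∀ N {e} → (∀ k → 0# ≤ e k) → Σ< N e ≤ 1# →
                         ∀ k → k ℕ.≤ N → 0# ≤ withSink N e k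
  withSink-nonNegative N {e} 0≤e Σ≤1 k k≤N with ℕ.m≤n⇒m<n∨m≡n k≤N
  ... | inj₁ k<N    = ≤-respʳ-≈ (sym (reflexive (withSink-inside e k<N))) (0≤e k)
  ... | inj₂ ≡.refl = ≤-respʳ-≈ (sym (withSink-sink N e)) (x≤y⇒0≤y-x Σ≤1)

  module _ (E : ⟦ gameTy ⟧) where
    γ₀ : Carrier
    γ₀ = proj₁ E

    sts : List ⟦ stateTy ⟧
    sts = proj₂ E

    n₀ : ℕ
    n₀ = length sts

    stateAt : ℕ → ⟦ stateTy ⟧
    stateAt = lookupOr (default stateTy) sts

    M N : ℕ
    M = iterate (λ m j → m ℕ.+ length (proj₂ (stateAt j))) 0 n₀
    N = iterate (λ s _ → s ℕ.+ n₀) 0 M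

    δ : Carrier
    δ = slower γ₀ M

    level : ℕ → ℕ
    level s = proj₁ (position n₀ s)

    origin : ℕ → ⟦ stateTy ⟧
    origin s = stateAt (proj₂ (position n₀ s))

    scale : ℕ → Carrier
    scale s = pow (δ ⁻¹) (level s)

    continues : ℕ → Bool
    continues s = 2 ℕ.+ level s ℕ.≤ᵇ length (proj₂ (origin s))

    count : ℕ → ℕ
    count s = if continues s then 2 else 1

    -- For s = N, and whenever level s is not an action of the original state, this
    -- is the default, so that s has a single action, which leads to the sink.
    action : ℕ → ⟦ actionTy ⟧
    action s = lookupOr (default actionTy) (proj₂ (origin s)) (level s)

    reward : ℕ → ℕ → Carrier
    reward s t = if t ℕ.≤ᵇ 0 then proj₁ (action s) * scale s else 0#

    weight : ℕ → ℕ → ℕ → Carrier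
    weight s t k = if t ℕ.≤ᵇ 0
      then γ₀ * (scale s * δ ⁻¹) * lookupOr 0# (proj₂ (action s)) k
      else (if k ℕ.≤ᵇ s ℕ.+ n₀ then (if s ℕ.+ n₀ ℕ.≤ᵇ k then 1# else 0#) else 0#)

    imageAction : ℕ → ℕ → ⟦ actionTy ⟧
    imageAction s t = reward s t , applyUpTo (withSink N (weight s t)) (suc N)

    imageState : ℕ → ⟦ stateTy ⟧
    imageState s = proj₁ (origin s) , applyUpTo (imageAction s) (count s)

    image : ⟦ gameTy ⟧
    image = δ , applyUpTo imageState (suc N)

-- The binary game and the values along its chains.

module Reduction (ℝ : Reals) (G : StochasticGames.Game ℝ) where
  open Reals ℝ
  open StochasticGames ℝ
  open OrderedField ℝ
  open Optima ℝ
  open Image ℝ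

  private
    E : ⟦ gameTy ⟧
    E = encode G

    encodeAction : (j : Fin (n G)) → Fin (a G j) → ⟦ actionTy ⟧
    encodeAction j i = r G j i , tabulate (p G j i)

    encodeState : Fin (n G) → ⟦ stateTy ⟧
    encodeState j = isMax (owner G j) , tabulate (encodeAction j)

  n₀≡n : n₀ E ≡ n G
  n₀≡n = length-tabulate encodeState

  N≡M*n₀ : N E ≡ M E ℕ.* n₀ E
  N≡M*n₀ = iterate-+-const (n₀ E) (M E)

  stateAt-toℕ : ∀ j → stateAt E (toℕ j) ≡ encodeState j
  stateAt-toℕ = lookupOr-tabulate (default stateTy) encodeState

  toℕ<n₀ : (j : Fin (n G)) → toℕ j ℕ.< n₀ E
  toℕ<n₀ j = ≡.subst (toℕ j ℕ.<_) (≡.sym n₀≡n) (toℕ<n j)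

  length-actions≤M : ∀ {j} → j ℕ.< n₀ E → length (proj₂ (stateAt E j)) ℕ.≤ M E
  length-actions≤M = iterate-+-≥ (λ j → length (proj₂ (stateAt E j))) (n₀ E)

  length-actions : ∀ j → length (proj₂ (stateAt E (toℕ j))) ≡ a G j
  length-actions j = ≡.trans (≡.cong (length ∘ proj₂) (stateAt-toℕ j))
                             (length-tabulate (encodeAction j))

  a≤M : ∀ j → a G j ℕ.≤ M E
  a≤M j = ≡.subst (ℕ._≤ M E) (length-actions j) (length-actions≤M (toℕ<n₀ j))

  -- n ≤ M n requires M ≥ 1, which the given state provides by having an action.
  n₀≤N : Fin (n G) → n₀ E ℕ.≤ N E
  n₀≤N j = ≡.subst (n₀ E ℕ.≤_) (≡.sym N≡M*n₀)
    (ℕ.m≤n*m (n₀ E) (M E) {{ℕ.>-nonZero (ℕ.≤-trans (a≥1 G j) (a≤M j))}})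

  -- Either a genuine action, at a level below M, so that its inflated weights are under control, or
  -- padding without reward and transitions.
  action-view : ∀ s →
    (∃[ j ] ∃[ i ] action E s ≡ encodeAction j i × suc (level E s) ℕ.≤ M E) ⊎
    action E s ≡ default actionTy
  action-view s
    with lookupOr-tabulate-view (default stateTy) encodeState (proj₂ (position (n₀ E) s))
  ... | inj₂ eq = inj₂ (≡.cong (λ st → lookupOr (default actionTy) (proj₂ st) (level E s)) eq)
  ... | inj₁ (j , _ , eq)
    with lookupOr-tabulate-view (default actionTy) (encodeAction j) (level E s)
  ...   | inj₁ (i , i≡ , eq′) = inj₁ (j , i ,
            ≡.trans (≡.cong (λ st → lookupOr (default actionTy) (proj₂ st) (level E s)) eq) eq′ ,
            ≡.subst (ℕ._< M E) (≡.sym i≡) (ℕ.≤-trans (toℕ<n i) (a≤M j)))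
  ...   | inj₂ eq′            = inj₂
            (≡.trans (≡.cong (λ st → lookupOr (default actionTy) (proj₂ st) (level E s)) eq) eq′)

  0≤δ : 0# ≤ δ E
  0≤δ = slower-nonNegative (0≤γ G) (γ<1 G) (M E)

  0≤factor : ∀ s → 0# ≤ γ G * (scale E s * δ E ⁻¹)
  0≤factor s = *-nonNegative (0≤γ G) (pow-nonNegative (suc (level E s)) 0≤δ⁻¹)
    where
    0≤δ⁻¹ : 0# ≤ δ E ⁻¹
    0≤δ⁻¹ = 0≤slower⁻¹ (0≤γ G) (γ<1 G) (M E)

  row-nonNegative : ∀ s k → 0# ≤ lookupOr 0# (proj₂ (action E s)) k
  row-nonNegative s k with action-view s
  ... | inj₁ (j , i , eq , _) rewrite eq with lookupOr-tabulate-view 0# (p G j i) k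
  ...   | inj₁ (k′ , _ , eq′) = ≤-respʳ-≈ (sym (reflexive eq′)) (0≤p G j i k′)
  ...   | inj₂ eq′            = ≤-respʳ-≈ (sym (reflexive eq′)) ≤-refl
  row-nonNegative s k | inj₂ eq rewrite eq = ≤-refl

  weight-nonNegative : ∀ s t k → 0# ≤ weight E s t k
  weight-nonNegative s t k = if-elim (0# ≤_) (t ℕ.≤ᵇ 0)
    (*-nonNegative (0≤factor s) (row-nonNegative s k))
    (if-elim (0# ≤_) (k ℕ.≤ᵇ s ℕ.+ n₀ E) (if-elim (0# ≤_) (s ℕ.+ n₀ E ℕ.≤ᵇ k) 0≤1 ≤-refl) ≤-refl)

  -- State (k , 0) has index k, so the entries of an original row are already in place.
  Σ<-row : ∀ j i (w : ℕ → Carrier) →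
    Σ< (N E) (λ k → lookupOr 0# (tabulate (p G j i)) k * w k) ≈
    ∑ (λ k → p G j i k * w (toℕ k))
  Σ<-row j i w = begin-equality
    Σ< (N E) (λ k → row k * w k)     ≈⟨ Σ<-truncate n≤N beyond ⟩
    Σ< (n G) (λ k → row k * w k)     ≈⟨ ∑≈Σ< (n G) _ _ inside ⟨
    ∑ (λ k → p G j i k * w (toℕ k))  ∎
    where
    row : ℕ → Carrier
    row = lookupOr 0# (tabulate (p G j i))
    n≤N : n G ℕ.≤ N E
    n≤N = ≡.subst (ℕ._≤ N E) n₀≡n (n₀≤N j)
    beyond : ∀ {k} → n G ℕ.≤ k → row k * w k ≈ 0#
    beyond {k} n≤k = trans (*-congʳ (reflexive (lookupOr-beyond 0# (tabulate (p G j i))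
      (≡.subst (ℕ._≤ k) (≡.sym (length-tabulate (p G j i))) n≤k)))) (zeroˡ _)
    inside : ∀ k → p G j i k * w (toℕ k) ≈ row (toℕ k) * w (toℕ k)
    inside k = *-congʳ (reflexive (≡.sym (lookupOr-tabulate 0# (p G j i) k)))

  Σ<-weight-take : ∀ s (w : ℕ → Carrier) →
    Σ< (N E) (λ k → weight E s 0 k * w k) ≈
    γ G * (scale E s * δ E ⁻¹) * Σ< (N E) (λ k → lookupOr 0# (proj₂ (action E s)) k * w k)
  Σ<-weight-take s w = trans (Σ<-cong (N E) (λ _ → *-assoc _ _ _)) (Σ<-*ˡ (N E) _ _)

  -- The point mass at s, in the form to which `weight` reduces for moving on.
  step : ℕ → ℕ → Carrier
  step s k = if k ℕ.≤ᵇ s then (if s ℕ.≤ᵇ k then 1# else 0#) else 0#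

  step-diag : ∀ s → step s s ≡ 1#
  step-diag s = ≡.trans (if-≤ (ℕ.≤-refl {s})) (if-≤ (ℕ.≤-refl {s}))

  step-off : ∀ s {k} → ¬ (k ≡ s) → step s k ≡ 0#
  step-off s {k} k≢s with ℕ.<-cmp k s
  ... | tri< k<s _ _ = ≡.trans (if-≤ (ℕ.<⇒≤ k<s)) (if-> k<s)
  ... | tri≈ _ k≡s _ = ⊥-elim (k≢s k≡s)
  ... | tri> _ _ s<k = if-> s<k

  Σ<-step : ∀ {s} (w : ℕ → Carrier) → s ℕ.< N E → Σ< (N E) (λ k → step s k * w k) ≈ w s
  Σ<-step {s} w s<N = trans
    (Σ<-single (N E) s<N λ k≢s → trans (*-congʳ (reflexive (step-off s k≢s))) (zeroˡ _))
    (trans (*-congʳ (reflexive (step-diag s))) (*-identityˡ _))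

  -- Makes the remainder for the sink nonnegative. Taking action i has total weight γ δ⁻ⁱ⁻¹, or 0
  -- for padding; moving on has weight 1, or 0 where it would leave the grid.
  Σ<-weight≤1 : ∀ s t → Σ< (N E) (weight E s t) ≤ 1#
  Σ<-weight≤1 s zero    = begin
    Σ< (N E) (weight E s 0)
      ≈⟨ Σ<-cong (N E) (λ _ → sym (*-identityʳ _)) ⟩
    Σ< (N E) (λ k → weight E s 0 k * 1#)
      ≈⟨ Σ<-weight-take s (λ _ → 1#) ⟩
    γ G * (scale E s * δ E ⁻¹) * Σ< (N E) (λ k → lookupOr 0# (proj₂ (action E s)) k * 1#)
      ≤⟨ bound (action-view s) ⟩
    1# ∎
    where
    bound : _ → γ G * (scale E s * δ E ⁻¹) *
                Σ< (N E) (λ k → lookupOr 0# (proj₂ (action E s)) k * 1#) ≤ 1#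
    bound (inj₁ (j , i , eq , i<M)) rewrite eq = begin
      γ G * (scale E s * δ E ⁻¹) * Σ< (N E) (λ k → lookupOr 0# (tabulate (p G j i)) k * 1#)
        ≈⟨ *-congˡ (Σ<-row j i (λ _ → 1#)) ⟩
      γ G * (scale E s * δ E ⁻¹) * ∑ (λ k → p G j i k * 1#)
        ≈⟨ *-congˡ (trans (∑-cong (n G) (λ k → *-identityʳ _)) (p-total G j i)) ⟩
      γ G * (scale E s * δ E ⁻¹) * 1#
        ≈⟨ *-identityʳ _ ⟩
      γ G * (scale E s * δ E ⁻¹)
        ≤⟨ γ*pow-slower⁻¹≤1 (0≤γ G) (γ<1 G) (M E) i<M ⟩
      1# ∎
    bound (inj₂ eq) rewrite eq = begin
      γ G * (scale E s * δ E ⁻¹) * Σ< (N E) (λ k → 0# * 1#)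
        ≈⟨ *-congˡ (Σ<-zero (N E) (λ _ → zeroˡ 1#)) ⟩
      γ G * (scale E s * δ E ⁻¹) * 0#   ≈⟨ zeroʳ _ ⟩
      0#                                ≤⟨ 0≤1 ⟩
      1# ∎
  Σ<-weight≤1 s (suc t) with ℕ.<-≤-connex (s ℕ.+ n₀ E) (N E)
  ... | inj₁ s+n₀<N = begin
    Σ< (N E) (step (s ℕ.+ n₀ E))               ≈⟨ Σ<-cong (N E) (λ _ → sym (*-identityʳ _)) ⟩
    Σ< (N E) (λ k → step (s ℕ.+ n₀ E) k * 1#)  ≈⟨ Σ<-step (λ _ → 1#) s+n₀<N ⟩
    1#                                         ∎
  ... | inj₂ N≤s+n₀ = ≤-trans (≤-reflexive (Σ<-zero (N E) λ k<N →
    reflexive (step-off (s ℕ.+ n₀ E) (ℕ.<⇒≢ (ℕ.<-≤-trans k<N N≤s+n₀))))) 0≤1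

  binary : Game
  binary = record
    { n       = suc (N E)
    ; owner   = λ s → toPlayer (proj₁ (origin E (toℕ s)))
    ; a       = λ s → count E (toℕ s)
    ; a≥1     = λ s → if-elim (1 ℕ.≤_) (continues E (toℕ s)) (s≤s z≤n) (s≤s z≤n)
    ; r       = λ s t → reward E (toℕ s) (toℕ t)
    ; p       = λ s t k → withSink (N E) (weight E (toℕ s) (toℕ t)) (toℕ k)
    ; 0≤p     = λ s t k → 0≤row (toℕ s) (toℕ t) k
    ; p≤1     = λ s t k → ≤-trans (∑-≥-term _ (0≤row (toℕ s) (toℕ t)) k)
                            (≤-reflexive (∑-withSink (N E) (weight E (toℕ s) (toℕ t))))
    ; p-total = λ s t → ∑-withSink (N E) (weight E (toℕ s) (toℕ t))
    ; γ       = δ E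
    ; 0≤γ     = 0≤δ
    ; γ<1     = slower<1 (0≤γ G) (γ<1 G) (M E)
    }
    where
    0≤row : ∀ s t (k : Fin (suc (N E))) → 0# ≤ withSink (N E) (weight E s t) (toℕ k)
    0≤row s t k = withSink-nonNegative (N E) (weight-nonNegative s t) (Σ<-weight≤1 s t)
      (toℕ k) (ℕ.s≤s⁻¹ (toℕ<n k))

  binary-isBinary : Binary binary
  binary-isBinary s = if-elim (ℕ._≤ 2) (continues E (toℕ s)) ℕ.≤-refl (s≤s z≤n)

  -- Only the passage from naturals to `Fin` is left to prove. As `image E` is the evaluated program
  -- by definition, this is also the correctness of `binaryProgram`.
  image≡encode : image E ≡ encode binary
  image≡encode = ≡.cong (δ E ,_)
    (≡.trans (applyUpTo-toℕ (imageState E) (suc (N E))) (tabulate-cong λ s →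
      ≡.cong₂ _,_ (≡.sym (isMax-toPlayer (proj₁ (origin E (toℕ s)))))
        (≡.trans (applyUpTo-toℕ (imageAction E (toℕ s)) (count E (toℕ s))) (tabulate-cong λ t →
          ≡.cong (reward E (toℕ s) (toℕ t) ,_)
            (applyUpTo-toℕ (withSink (N E) (weight E (toℕ s) (toℕ t))) (suc (N E)))))))

  -- State j survives as (j , 0), which has index j.
  recover : Vector Carrier (suc (N E)) → Vector Carrier (n G)
  recover w j = lookupOr 0# (tabulate w) (toℕ j)

  module _ (w : Vector Carrier (suc (N E))) (sol : IsSolution binary w) where
    private
      w′ : ℕ → Carrier
      w′ = lookupOr 0# (tabulate w)

      w′-toℕ : ∀ k → w k ≈ w′ (toℕ k)
      w′-toℕ k = reflexive (≡.sym (lookupOr-tabulate 0# w k))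

    value : ℕ → ℕ → Carrier
    value s t = reward E s t + δ E *
      (Σ< (N E) (λ k → weight E s t k * w′ k) + withSink (N E) (weight E s t) (N E) * w′ (N E))

    SolvedAt : ℕ → Set
    SolvedAt s = Σ[ f ∈ Vector Carrier (count E s) ]
      (w′ s isOptimal[ toPlayer (proj₁ (origin E s)) ] f × (∀ t → f t ≈ value s (toℕ t)))

    solvedAt : ∀ {s} → s ℕ.≤ N E → SolvedAt s
    solvedAt s≤N = ≡.subst SolvedAt (toℕ-fromℕ< (s≤s s≤N)) (solvedAt-toℕ (fromℕ< (s≤s s≤N)))
      where
      solvedAt-toℕ : ∀ k → SolvedAt (toℕ k)
      solvedAt-toℕ k = _ , optimal-resp (toPlayer (proj₁ (origin E (toℕ k)))) (w′-toℕ k) (sol k) ,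
        λ t → +-congˡ (*-congˡ (∑-withSink-* (N E) (weight E (toℕ k) (toℕ t)) w w′ w′-toℕ))

    -- Index N = M n has position (M , 0), and level M lies beyond the actions of state 0. So the
    -- sink has one action, without reward and back to itself, and its value satisfies w = δ w.
    sink-value : Fin (n G) → w′ (N E) ≈ 0#
    sink-value j = fixed-by-contraction (proj₂ (slower<1 (0≤γ G) (γ<1 G) (M E))) (begin-equality
      w′ (N E)
        ≈⟨ optimal-of-1 (toPlayer (proj₁ (origin E (N E)))) {g = value (N E)} count≡1
             (proj₂ (proj₂ at)) (proj₁ (proj₂ at)) ⟩
      value (N E) 0
        ≈⟨ +-cong reward≈0 (*-congˡ (+-cong Σ≈0 (*-congʳ stay≈1))) ⟩
      0# + δ E * (0# + 1# * w′ (N E))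
        ≈⟨ trans (+-identityˡ _) (*-congˡ (trans (+-identityˡ _) (*-identityˡ _))) ⟩
      δ E * w′ (N E) ∎)
      where
      at : SolvedAt (N E)
      at = solvedAt ℕ.≤-refl
      0<n₀ : 0 ℕ.< n₀ E
      0<n₀ = ℕ.≤-<-trans z≤n (toℕ<n₀ j)
      position≡ : position (n₀ E) (N E) ≡ (M E , 0)
      position≡ = ≡.trans (≡.cong (position (n₀ E)) N≡M*n₀) (position-correct (M E) 0<n₀)
      beyond : length (proj₂ (origin E (N E))) ℕ.≤ level E (N E)
      beyond rewrite position≡ = length-actions≤M 0<n₀
      count≡1 : count E (N E) ≡ 1
      count≡1 = if-> (s≤s (ℕ.m≤n⇒m≤1+n beyond))
      action≡ : action E (N E) ≡ default actionTy
      action≡ = lookupOr-beyond (default actionTy) (proj₂ (origin E (N E))) beyond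
      reward≈0 : reward E (N E) 0 ≈ 0#
      reward≈0 = trans (*-congʳ (reflexive (≡.cong proj₁ action≡))) (zeroˡ _)
      weight≈0 : ∀ k → weight E (N E) 0 k ≈ 0#
      weight≈0 k = trans (*-congˡ (reflexive (≡.cong (λ act → lookupOr 0# (proj₂ act) k) action≡)))
                         (zeroʳ _)
      Σ≈0 : Σ< (N E) (λ k → weight E (N E) 0 k * w′ k) ≈ 0#
      Σ≈0 = Σ<-zero (N E) (λ {k} _ → trans (*-congʳ (weight≈0 k)) (zeroˡ _))
      Σweight≈0 : Σ< (N E) (weight E (N E) 0) ≈ 0#
      Σweight≈0 = Σ<-zero (N E) (λ {k} _ → weight≈0 k)
      stay≈1 : withSink (N E) (weight E (N E) 0) (N E) ≈ 1#
      stay≈1 = begin-equality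
        withSink (N E) (weight E (N E) 0) (N E)   ≈⟨ withSink-sink (N E) _ ⟩
        1# + - Σ< (N E) (weight E (N E) 0)        ≈⟨ +-congˡ (-‿cong Σweight≈0) ⟩
        1# + - 0#                                 ≈⟨ +-identityʳ _ ⟨
        1# + - 0# + 0#                            ≈⟨ x-y+y≈x 1# 0# ⟩
        1#                                        ∎

    module _ (j : Fin (n G)) where
      private
        o : Player
        o = owner G j

        index : ℕ → ℕ
        index i = toℕ j ℕ.+ i ℕ.* n₀ E

        acts : List ⟦ actionTy ⟧
        acts = proj₂ (stateAt E (toℕ j))

        act : ℕ → ⟦ actionTy ⟧
        act = lookupOr (default actionTy) acts

      -- The value of action i in state j under the recovered values, still summed over the whole
      -- grid.
      original : ℕ → Carrier
      original i = proj₁ (act i) + γ G * Σ< (N E) (λ k → lookupOr 0# (proj₂ (act i)) k * w′ k)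

      index<N : ∀ {i} → i ℕ.< a G j → index i ℕ.< N E
      index<N {i} i<a = ≡.subst (index i ℕ.<_) (≡.sym N≡M*n₀)
        (ℕ.<-≤-trans (ℕ.+-monoˡ-< (i ℕ.* n₀ E) (toℕ<n₀ j))
                    (ℕ.*-monoˡ-≤ (n₀ E) (ℕ.≤-trans i<a (a≤M j))))

      module _ {i} (i<a : i ℕ.< a G j) where
        private
          s : ℕ
          s = index i

          c : Carrier
          c = pow (δ E ⁻¹) i

          position≡ : position (n₀ E) s ≡ (i , toℕ j)
          position≡ = position-correct i (toℕ<n₀ j)

          d*c : pow (δ E) i * c ≈ 1#
          d*c = pow-inverse i (slower-inverse (0≤γ G) (γ<1 G) (M E))

          origin≡ : origin E s ≡ stateAt E (toℕ j)
          origin≡ = ≡.cong (stateAt E ∘ proj₂) position≡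

          origin-owner : toPlayer (proj₁ (origin E s)) ≡ o
          origin-owner = ≡.trans (≡.cong (toPlayer ∘ proj₁) (≡.trans origin≡ (stateAt-toℕ j)))
                                 (toPlayer-isMax o)

          length≡ : length (proj₂ (origin E s)) ≡ a G j
          length≡ = ≡.trans (≡.cong (length ∘ proj₂) origin≡) (length-actions j)

          level≡ : level E s ≡ i
          level≡ = ≡.cong proj₁ position≡

        value≈ : ∀ t → value s t ≈ reward E s t + δ E * Σ< (N E) (λ k → weight E s t k * w′ k)
        value≈ t = +-congˡ (*-congˡ
          (trans (+-congˡ (trans (*-congˡ (sink-value j)) (zeroʳ _))) (+-identityʳ _)))

        -- δⁱ cancels the factor δ⁻ⁱ of the reward and, together with the discount δ, the factor
        -- δ⁻ⁱ⁻¹ of the probabilities.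
        take-value : pow (δ E) i * value s 0 ≈ original i
        take-value = begin-equality
          pow (δ E) i * value s 0
            ≈⟨ *-congˡ (value≈ 0) ⟩
          pow (δ E) i * (reward E s 0 + δ E * Σ< (N E) (λ k → weight E s 0 k * w′ k))
            ≈⟨ *-congˡ (+-congˡ (*-congˡ (Σ<-weight-take s w′))) ⟩
          pow (δ E) i * (reward E s 0 + δ E * (γ G * (scale E s * δ E ⁻¹) *
            Σ< (N E) (λ k → lookupOr 0# (proj₂ (action E s)) k * w′ k)))
            -- Abstracting over the position rewrites the level and the original state at once.
            ≈⟨ reflexive (≡.cong expression position≡) ⟩
          pow (δ E) i * (proj₁ (act i) * c + δ E * (γ G * (c * δ E ⁻¹) * S))
            ≈⟨ *-congˡ (+-cong (*-comm _ c) cancel) ⟩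
          pow (δ E) i * (c * proj₁ (act i) + c * (γ G * S))
            ≈⟨ *-congˡ (distribˡ c _ _) ⟨
          pow (δ E) i * (c * original i)
            ≈⟨ *-assoc _ _ _ ⟨
          pow (δ E) i * c * original i
            ≈⟨ trans (*-congʳ d*c) (*-identityˡ _) ⟩
          original i ∎
          where
          S : Carrier
          S = Σ< (N E) (λ k → lookupOr 0# (proj₂ (act i)) k * w′ k)
          expression : ℕ × ℕ → Carrier
          expression (l , m) = pow (δ E) i * (proj₁ x * pow (δ E ⁻¹) l +
            δ E * (γ G * (pow (δ E ⁻¹) l * δ E ⁻¹) *
              Σ< (N E) (λ k → lookupOr 0# (proj₂ x) k * w′ k)))
            where
            x : ⟦ actionTy ⟧
            x = lookupOr (default actionTy) (proj₂ (stateAt E m)) l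
          cancel : δ E * (γ G * (c * δ E ⁻¹) * S) ≈ c * (γ G * S)
          cancel = begin-equality
            δ E * (γ G * (c * δ E ⁻¹) * S)   ≈⟨ *-congˡ (*-xy∙z≈xz∙y (γ G) _ S) ⟩
            δ E * (γ G * S * (c * δ E ⁻¹))   ≈⟨ *-congˡ (*-assoc _ c _) ⟨
            δ E * (γ G * S * c * δ E ⁻¹)     ≈⟨ *-x∙yz≈y∙xz (δ E) _ _ ⟩
            γ G * S * c * (δ E * δ E ⁻¹)     ≈⟨ *-congˡ (slower-inverse (0≤γ G) (γ<1 G) (M E)) ⟩
            γ G * S * c * 1#                 ≈⟨ *-identityʳ _ ⟩
            γ G * S * c                      ≈⟨ *-comm _ c ⟩
            c * (γ G * S)                    ∎

        last-step : suc i ≡ a G j → pow (δ E) i * w′ s ≈ original i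
        last-step 1+i≡a = trans
          (*-congˡ (optimal-of-1 (toPlayer (proj₁ (origin E s))) {g = value s} (if-> (s≤s length≤))
                                 (proj₂ (proj₂ at)) (proj₁ (proj₂ at))))
          take-value
          where
          at : SolvedAt s
          at = solvedAt (ℕ.<⇒≤ (index<N i<a))
          length≤ : length (proj₂ (origin E s)) ℕ.≤ suc (level E s)
          length≤ = ℕ.≤-reflexive
            (≡.trans length≡ (≡.trans (≡.sym 1+i≡a) (≡.cong suc (≡.sym level≡))))

        -- The discount of moving on turns δⁱ into δⁱ⁺¹, the scale of the next level.
        continue-value : suc i ℕ.< a G j →
          pow (δ E) i * value s 1 ≈ pow (δ E) (suc i) * w′ (index (suc i))
        continue-value 1+i<a = begin-equality
          pow (δ E) i * value s 1
            ≈⟨ *-congˡ (trans (value≈ 1) (+-identityˡ _)) ⟩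
          pow (δ E) i * (δ E * Σ< (N E) (λ k → step (s ℕ.+ n₀ E) k * w′ k))
            ≈⟨ *-assoc _ _ _ ⟨
          pow (δ E) (suc i) * Σ< (N E) (λ k → step (s ℕ.+ n₀ E) k * w′ k)
            ≈⟨ *-congˡ (Σ<-step w′ (≡.subst (ℕ._< N E) (≡.sym next) (index<N 1+i<a))) ⟩
          pow (δ E) (suc i) * w′ (s ℕ.+ n₀ E)
            ≈⟨ *-congˡ (reflexive (≡.cong w′ next)) ⟩
          pow (δ E) (suc i) * w′ (index (suc i)) ∎
          where
          next : s ℕ.+ n₀ E ≡ index (suc i)
          next = ≡.trans (ℕ.+-assoc (toℕ j) _ _) (≡.cong (toℕ j ℕ.+_) (ℕ.+-comm _ (n₀ E)))

        chain-step : suc i ℕ.< a G j → (pow (δ E) i * w′ s) isOptimal₂[ o ] original i ,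
                                       (pow (δ E) (suc i) * w′ (index (suc i)))
        chain-step 1+i<a = ≡.subst
          (λ q → (pow (δ E) i * w′ s) isOptimal₂[ q ] original i ,
                                      (pow (δ E) (suc i) * w′ (index (suc i))))
          origin-owner
          (optimal₂-scale (toPlayer (proj₁ (origin E s))) (pow (δ E) i) (pow-nonNegative i 0≤δ)
            take-value (continue-value 1+i<a)
            (optimal-of-2 (toPlayer (proj₁ (origin E s))) {g = value s}
              (if-≤ (≡.subst₂ ℕ._≤_ (≡.cong (2 ℕ.+_) (≡.sym level≡)) (≡.sym length≡) 1+i<a))
              (proj₂ (proj₂ at)) (proj₁ (proj₂ at))))
          where
          at : SolvedAt s
          at = solvedAt (ℕ.<⇒≤ (index<N i<a))

    -- The chain argument is applied to u i = δⁱ w (j , i), whose start u 0 is the recovered value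
    -- of j.
    recover-isSolution : IsSolution G (recover w)
    recover-isSolution j = optimal-resp (owner G j)
      (trans (*-identityˡ _) (reflexive (≡.cong w′ (ℕ.+-identityʳ (toℕ j)))))
      (optimal-of-chain (owner G j) (a G j) _ (original j)
        (λ i → pow (δ E) i * w′ (toℕ j ℕ.+ i ℕ.* n₀ E))
        (a≥1 G j) original≈
        (λ 1+i<a → chain-step j (ℕ.<⇒≤ 1+i<a) 1+i<a)
        (λ 1+i≡a → last-step j (ℕ.≤-reflexive 1+i≡a) 1+i≡a))
      where
      original≈ : ∀ i → r G j i + γ G * ∑ (λ k → p G j i k * recover w k) ≈ original j (toℕ i)
      original≈ i rewrite stateAt-toℕ j | lookupOr-tabulate (default actionTy) (encodeAction j) i =
        +-congˡ (*-congˡ (sym (Σ<-row j i w′)))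

-- Polynomial running time of the two programs.

module Complexity (ℝ : Reals) where
  open StochasticGames ℝ
  open Cost ℝ
  open Programs ℝ
  open Reduction ℝ

  gameSize : Game → ℕ
  gameSize G = states G ℕ.+ actions G

  stronglyPolynomial : ∀ {I : Set} {game : I → Game} {σ τ} {input : I → ⟦ σ ⟧} {output : I → ⟦ τ ⟧}
    (t : Program σ τ) → Tame t → (P : Poly) →
    (∀ x → Bounded (⟪ P ⟫ (gameSize (game x))) σ (input x)) →
    (∀ x → eval t (input x ∷ []) ≡ output x) →
    StronglyPolynomial game σ τ input output
  stronglyPolynomial {game = game} t t-tame P input-bound correct = record
    { program = t
    ; correct = correct
    ; c       = coeff (cost t t-tame ⊙ P)
    ; d       = deg (cost t t-tame ⊙ P)
    ; bound   = λ x → ℕ.≤-trans (steps-bound t t-tame (input-bound x ∷ []))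
                                (⟪⟫-≤ (cost t t-tame ⊙ P) (gameSize (game x)))
    }

  Bounded-encode : ∀ G → Bounded (gameSize G) gameTy (encode G)
  Bounded-encode G = tt , Bounded-tabulate stateTy _ n≤ λ j →
    tt , Bounded-tabulate actionTy _ (ℕ.m≤n⇒m≤o+n (n G) (term-≤-sum (a G) j)) λ i →
    tt , Bounded-tabulate real _ n≤ λ _ → tt
    where
    n≤ : n G ℕ.≤ gameSize G
    n≤ = ℕ.m≤m+n (n G) _

  length-encode : ∀ G → length (proj₂ (encode G)) ≡ n G
  length-encode G = length-tabulate {n = n G} _

  -- Recovery reads a vector with one entry per state of the image. Since a tame program has output
  -- of polynomial size, the length of that vector is bounded without an estimate of M n + 1.
  states-bound : ∀ {B : Game → Game} (t : Program gameTy gameTy) → Tame t →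
                 (∀ G → eval t (encode G ∷ []) ≡ encode (B G)) →
                 Σ[ P ∈ Poly ] (∀ G → states (B G) ℕ.≤ ⟪ P ⟫ (gameSize G))
  states-bound {B} t t-tame correct = cost t t-tame , λ G →
    ≡.subst (ℕ._≤ ⟪ cost t t-tame ⟫ (gameSize G))
      (≡.trans (≡.cong (length ∘ proj₂) (correct G)) (length-encode (B G)))
      (proj₁ (proj₂ (value-bound t t-tame (Bounded-encode G ∷ []))))

  binary-stronglyPolynomial : StronglyPolynomial id gameTy gameTy encode (encode ∘ binary)
  binary-stronglyPolynomial =
    stronglyPolynomial binaryProgram binaryProgram-tame X Bounded-encode image≡encode

  recover-stronglyPolynomial :
    Σ[ P ∈ Poly ] (∀ G → states (binary G) ℕ.≤ ⟪ P ⟫ (gameSize G)) →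
    StronglyPolynomial proj₁ (gameTy ⊗ arr real) (arr real)
      (recoverInput binary) (recoverOutput binary recover)
  recover-stronglyPolynomial (P , states≤P) =
    stronglyPolynomial recoverProgram _ (X ⊕ P) input-bound correct
    where
    input-bound : ∀ x → Bounded (⟪ X ⊕ P ⟫ (gameSize (proj₁ x)))
                                (gameTy ⊗ arr real) (recoverInput binary x)
    input-bound (G , w , _) =
      Bounded-mono gameTy {encode G} (ℕ.m≤m+n (gameSize G) _) (Bounded-encode G) ,
      Bounded-tabulate real w (ℕ.m≤n⇒m≤o+n (gameSize G) (states≤P G)) λ _ → tt
    correct : ∀ x → eval recoverProgram (recoverInput binary x ∷ []) ≡
                    recoverOutput binary recover x
    correct (G , w , _) = ≡.trans (≡.cong (applyUpTo _) (length-encode G)) (applyUpTo-toℕ _ (n G))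

theorem11p2 : (ℝ : Reals) →
    let open Reals ℝ using (Carrier)
        open StochasticGames ℝ in
    Σ[ binary ∈ (Game → Game) ]
      (∀ G → Binary (binary G)) ×
      StronglyPolynomial id gameTy gameTy encode (encode ∘ binary) ×
      Σ[ recover ∈ ((G : Game) → Vector Carrier (n (binary G)) → Vector Carrier (n G)) ]
        (∀ G w → IsSolution (binary G) w → IsSolution G (recover G w)) ×
        StronglyPolynomial proj₁ (gameTy ⊗ arr real) (arr real)
          (recoverInput binary) (recoverOutput binary recover)
theorem11p2 ℝ =
  binary , binary-isBinary , binary-stronglyPolynomial ,
  recover , recover-isSolution , recover-stronglyPolynomial
    (states-bound {binary} binaryProgram binaryProgram-tame image≡encode)
  where
  open Reduction ℝ
  open Complexity ℝ
  open Programs ℝ using (binaryProgram; binaryProgram-tame)
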